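{- Let $m$ be a string transduction and let $k\ge1$. If $m\in\mathrm{NGSM}^k$ and $m$ is finitary, then $m\in\mathrm{MREL}\,;\,\mathrm{DGSM}$.
   Context: A relation $R$ is finitary if $\{z\mid(w,z)\in R\}$ is finite for each $w$ in its domain. Composition: $R_1;R_2=\{(w_1,w_3)\mid\exists w_2:(w_1,w_2)\in R_1,(w_2,w_3)\in R_2\}$, extended to families elementwise; $\mathrm{NGSM}^k$ denotes $k$-fold compositions of transductions from $\mathrm{NGSM}$. 2gsm: $M=(Q,\Sigma_1,\Sigma_2,\delta,q_{in},q_f)$ with finite $Q$ and instructions $(p,\sigma,q_1,\alpha_1,\epsilon_1,q_0,\alpha_0,\epsilon_0)$, $p\ne q_f$, $\sigma\in\Sigma_1\cup\{\vdash,\dashv\}$, $\alpha_i\in\Sigma_2^*$, $\epsilon_i\in\{ -1,0,+1\}$; on input $w$ the read-only tape holds $\vdash w\dashv$; in state $p$ scanning $\tau$ any instruction starting with $p$ may be executed: enter $q_1$, output $\alpha_1$, move by $\epsilon_1$ if $\tau=\sigma$, otherwise use $(q_0,\alpha_0,\epsilon_0)$; $(w,z)$ is realized iff some computation from $q_{in}$ at position $0$ reaches $q_f$ with output $z$. $\mathrm{NGSM}$: transductions of 2gsm's; $\mathrm{DGSM}$: transductions of deterministic 2gsm's (at most one instruction per state). $\mathrm{MREL}$: marked relabellings, i.e. relations mapping $w$ to $\vdash w\dashv$ followed by a string relabelling; a string relabelling is given by $R\subseteq\Delta_1\times\Delta_2$ and relates $a_1\cdots a_n$ to every $b_1\cdots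 b_n$ with $(a_i,b_i)\in R$ for all $i$. -}

module Defs where

open import Data.Nat using (ℕ; zero; suc; _≤_)
open import Data.Fin using (Fin)
open import Data.List using (List; []; _∷_; _++_; length; map; _∷ʳ_)
open import Data.List.Membership.Propositional using (_∈_)
open import Data.List.Relation.Binary.Pointwise using (Pointwise)
open import Data.Maybe using (Maybe; just; nothing)
open import Data.Product using (Σ; ∃; _×_; _,_)
open import Data.Bool using (Bool; T)
open import Data.Empty using (⊥)
open import Relation.Binary.PropositionalEquality using (_≡_; _≢_)
open import Function.Bundles using (_⇔_)
open import Level using (Lift)

Rel : ℕ → ℕ → Set₁
Rel a b = List (Fin a) → List (Fin b) → Set

_≐_ : ∀ {a b} → Rel a b → Rel a b → Set
R ≐ S = ∀ w z → R w z ⇔ S w z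

_⨾_ : ∀ {a b c} → Rel a b → Rel b c → Rel a c
(R₁ ⨾ R₂) w₁ w₃ = ∃ λ w₂ → R₁ w₁ w₂ × R₂ w₂ w₃

-- finitary: { z | (w,z) ∈ R } is finite for every w
-- (finite = contained in some finite list; trivially so outside the domain)
Finitary : ∀ {a b} → Rel a b → Set
Finitary R = ∀ w → ∃ λ zs → ∀ z → R w z → z ∈ zs

Family : Set₂
Family = (a b : ℕ) → Rel a b → Set₁

data _⨾F_ (F G : Family) (a c : ℕ) (R : Rel a c) : Set₁ where
  comp : ∀ {b} (R₁ : Rel a b) (R₂ : Rel b c) →
         F a b R₁ → G b c R₂ → R ≐ (R₁ ⨾ R₂) → (F ⨾F G) a c R

-- k-fold composition F^k (only meaningful for k ≥ 1; F^0 is empty here)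
_^_ : Family → ℕ → Family
(F ^ zero) a b R = Lift _ ⊥
(F ^ suc zero) = F
(F ^ suc (suc k)) = F ⨾F (F ^ suc k)

data Sym (n : ℕ) : Set where
  ⊢ ⊣ : Sym n
  sym : Fin n → Sym n

data Move : Set where
  left stay right : Move

move : Move → ℕ → Maybe ℕ
move left zero    = nothing
move left (suc i) = just i
move stay i       = just i
move right i      = just (suc i)

-- symbol at position i of the tape ⊢ w ⊣ (positions 0 .. |w|+1)
tapeAt : ∀ {a} → List (Fin a) → ℕ → Maybe (Sym a)
tapeAt w zero                    = just ⊢
tapeAt [] (suc zero)             = just ⊣
tapeAt [] (suc (suc i))          = nothing
tapeAt (x ∷ w) (suc zero)        = just (sym x)
tapeAt (x ∷ w) (suc (suc i))     = tapeAt w (suc i)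

record Instr (nQ a b : ℕ) : Set where
  constructor instr
  field
    src  : Fin nQ
    σ    : Sym a
    q₁   : Fin nQ
    α₁   : List (Fin b)
    ε₁   : Move
    q₀   : Fin nQ
    α₀   : List (Fin b)
    ε₀   : Move

record TwoGSM (a b : ℕ) : Set where
  field
    nQ    : ℕ
    δ     : List (Instr nQ a b)
    q-in  : Fin nQ
    q-f   : Fin nQ
    src≢f : ∀ {ι} → ι ∈ δ → Instr.src ι ≢ q-f

Deterministic : ∀ {a b} → TwoGSM a b → Set
Deterministic M = ∀ {ι ι′} → ι ∈ δ → ι′ ∈ δ → Instr.src ι ≡ Instr.src ι′ → ι ≡ ι′
  where open TwoGSM M

module _ {a b : ℕ} (M : TwoGSM a b) (w : List (Fin a)) where
  open TwoGSM M
  open Instr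

  Conf : Set
  Conf = Fin nQ × ℕ

  data Step : Conf → List (Fin b) → Conf → Set where
    step-eq  : ∀ {ι i j} → ι ∈ δ → tapeAt w i ≡ just (σ ι) →
               move (ε₁ ι) i ≡ just j → j ≤ suc (length w) →
               Step (src ι , i) (α₁ ι) (q₁ ι , j)
    step-neq : ∀ {ι i j τ} → ι ∈ δ → tapeAt w i ≡ just τ → τ ≢ σ ι →
               move (ε₀ ι) i ≡ just j → j ≤ suc (length w) →
               Step (src ι , i) (α₀ ι) (q₀ ι , j)

  data Steps : Conf → List (Fin b) → Conf → Set where
    done : ∀ {c} → Steps c [] c
    _∷_  : ∀ {c α c′ β c″} → Step c α c′ → Steps c′ β c″ → Steps c (α ++ β) c″

  Realized : List (Fin b) → Set
  Realized z = ∃ λ j → Steps (q-in , 0) z (q-f , j)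

data NGSM (a b : ℕ) (R : Rel a b) : Set₁ where
  ngsm : (M : TwoGSM a b) → R ≐ Realized M → NGSM a b R

data DGSM (a b : ℕ) (R : Rel a b) : Set₁ where
  dgsm : (M : TwoGSM a b) → Deterministic M → R ≐ Realized M → DGSM a b R

Relabel : ∀ {A B : Set} → (A → B → Bool) → List A → List B → Set
Relabel Rl = Pointwise (λ x y → T (Rl x y))

marked : ∀ {a} → List (Fin a) → List (Sym a)
marked w = (⊢ ∷ map sym w) ∷ʳ ⊣

data MREL (a b : ℕ) (R : Rel a b) : Set₁ where
  mrel : (Rl : Sym a → Fin b → Bool) →
         R ≐ (λ w z → Relabel Rl (marked w) z) → MREL a b R

{-# OPTIONS --safe #-}
-- By induction on the number of factors it suffices to compose one 2gsm M, whose output is relabelled, with a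
-- deterministic two-way machine D. If some configuration of M is visited very often, two of the loops u and v
-- between visits can be chosen so that u and uv have the same two-way behaviour under D and that pumping u or uv
-- in its context preserves acceptance. As only finitely many outputs are possible, D is silent on both,
-- and cutting v does not change the output. So the visits to a configuration of M may be numbered by a bounded
-- index, and a run of M without repeated indexed configurations is guessed by a relabelling that writes on every
-- cell the successor and the predecessor of each indexed state. On the labelled tape D is simulated
-- deterministically: the run of M is followed forwards or backwards as the head of D moves, and comparing
-- successor with predecessor pointers on the way forward guarantees that the way back is the same.
module Submission where

open import Defs
open import Data.Nat using (ℕ; _≤_)
open import Data.Bool using (Bool; true; false; T)
open import Data.Bool.Properties using (T?)
open import Data.Empty using (⊥-elim)
open import Data.Fin using (Fin; zero; suc; toℕ; fromℕ; fromℕ<; inject₁; splitAt; join; combine; remQuot)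
import Data.Fin.Properties as Fin
open import Data.List
  using (List; []; _∷_; _++_; _∷ʳ_; _ʳ++_; length; map; take; drop; reverse; filter; allFin; concatMap;
         cartesianProductWith)
open import Data.List.Membership.Propositional using (_∈_)
open import Data.List.Membership.Propositional.Properties
  using (∈-map⁺; ∈-map⁻; ∈-filter⁺; ∈-filter⁻; ∈-allFin; ∈-++⁺ˡ; ∈-++⁺ʳ; ∈-++⁻;
         ∈-cartesianProductWith⁺; ∈-cartesianProductWith⁻)
import Data.List.Membership.DecPropositional as DecMembership
open import Data.List.Properties
  using (++-assoc; reverse-++; reverse-involutive; length-++; map-++; map-∘; map-cong; map-id)
open import Data.List.Relation.Binary.Pointwise using ([]; _∷_)
open import Data.List.Relation.Unary.All using (All; []; _∷_; all?)
import Data.List.Relation.Unary.All as All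
open import Data.List.Relation.Unary.All.Properties using (¬All⇒Any¬; ++⁻ˡ; ++⁻ʳ; gmap⁺)
open import Data.List.Relation.Unary.AllPairs using ([]; _∷_)
open import Data.List.Relation.Unary.Any using (here; there; satisfied)
open import Data.List.Relation.Unary.Unique.Propositional using (Unique)
open import Data.Maybe using (Maybe; just; nothing)
import Data.Maybe as Maybe
open import Data.Nat using (zero; suc; _+_; _*_; _∸_; _⊔_; _<_; z≤n; s≤s)
import Data.Nat.Properties as ℕ
open import Data.Nat.Properties hiding (_≟_)
open import Data.Nat.Induction using (<-wellFounded)
open import Data.Product using (∃; ∃₂; _×_; _,_; proj₁; proj₂)
open import Data.Product.Properties using (≡-dec)
open import Data.Sum using (_⊎_; inj₁; inj₂)
open import Data.Unit using (⊤; tt)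
open import Data.Vec using (Vec; []; _∷_; tabulate; lookup)
open import Data.Vec.Properties using (lookup∘tabulate)
open import Function using (_∘_; id)
open import Function.Bundles using (mk⇔; Equivalence)
import Induction.WellFounded as WF
open import Relation.Binary.Definitions using (DecidableEquality)
open import Relation.Binary.PropositionalEquality
  using (_≡_; _≢_; refl; trans; cong; cong₂; subst; subst₂) renaming (sym to ≡-sym)
open import Relation.Nullary using (¬_; Dec; yes; no; does)
open import Relation.Nullary.Decidable using (map′; isYes; toWitness; fromWitness; dec-true; dec-false)

-- The factors of a finitary composition need not be finitary, so finitarity cannot be the induction
-- hypothesis. `Good` asks for soundness on every input and for completeness only at inputs whose
-- outputs have bounded length: a bound for `Realized M ⨾ R` at `w` bounds `R` at each intermediate
-- word that M can produce from `w`.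
--
-- During pumping D may cross a loop many times in both directions, so the output of a loop is not a
-- factor of the total output. It is isolated by erasing the output of all other cells while leaving
-- every transition as it is.
--
-- The number of indices must not depend on the input, since otherwise no finite label alphabet
-- would do. It is computed from the number of behaviours of words under D with outputs erased.
--
-- A guessed labelling need not encode any run. So a successor pointer is followed only if it is a
-- transition of M, a predecessor pointer only where the way forward has confirmed it, and
-- acceptance by D counts only after the guessed run has been followed to its end.

-- Finite types and deterministic iteration

-- A retract of some Fin n: enough for decidable equality, pigeonhole and Fin-valued codes.
record Finite (X : Set) : Set where
  field
    size    : ℕ
    enc     : X → Fin size
    dec     : Fin size → X
    dec-enc : ∀ x → dec (enc x) ≡ x

  enc-injective : ∀ {x y} → enc x ≡ enc y → x ≡ y
  enc-injective {x} {y} eq = trans (≡-sym (dec-enc x)) (trans (cong dec eq) (dec-enc y))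

  infix 4 _≟_
  _≟_ : DecidableEquality X
  x ≟ y = map′ enc-injective (cong enc) (enc x Fin.≟ enc y)

open Finite

abstract
  Fin-finite : ∀ n → Finite (Fin n)
  Fin-finite n = record { size = n ; enc = id ; dec = id ; dec-enc = λ _ → refl }

  retract-finite : ∀ {X Y : Set} (f : X → Y) (g : Y → X) → (∀ x → g (f x) ≡ x) → Finite Y → Finite X
  retract-finite f g gf F = record
    { size = size F ; enc = enc F ∘ f ; dec = g ∘ dec F
    ; dec-enc = λ x → trans (cong g (dec-enc F (f x))) (gf x) }

  ⊤-finite : Finite ⊤
  ⊤-finite = retract-finite (λ _ → zero) (λ _ → tt) (λ _ → refl) (Fin-finite 1)

  ⊎-finite : ∀ {X Y : Set} → Finite X → Finite Y → Finite (X ⊎ Y)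
  ⊎-finite {X} {Y} F G = record
    { size = size F + size G ; enc = join (size F) (size G) ∘ code
    ; dec = decode ∘ splitAt (size F) ; dec-enc = retract }
    where
    code : X ⊎ Y → Fin (size F) ⊎ Fin (size G)
    code (inj₁ x) = inj₁ (enc F x)
    code (inj₂ y) = inj₂ (enc G y)

    decode : Fin (size F) ⊎ Fin (size G) → X ⊎ Y
    decode (inj₁ i) = inj₁ (dec F i)
    decode (inj₂ j) = inj₂ (dec G j)

    decode-code : ∀ x → decode (code x) ≡ x
    decode-code (inj₁ x) = cong inj₁ (dec-enc F x)
    decode-code (inj₂ y) = cong inj₂ (dec-enc G y)

    retract : ∀ x → decode (splitAt (size F) (join (size F) (size G) (code x))) ≡ x
    retract x = trans (cong decode (Fin.splitAt-join (size F) (size G) (code x))) (decode-code x)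

  ×-finite : ∀ {X Y : Set} → Finite X → Finite Y → Finite (X × Y)
  ×-finite {X} {Y} F G = record
    { size = size F * size G ; enc = code ; dec = decode ; dec-enc = retract }
    where
    code : X × Y → Fin (size F * size G)
    code (x , y) = combine (enc F x) (enc G y)

    decode-pair : Fin (size F) × Fin (size G) → X × Y
    decode-pair (i , j) = dec F i , dec G j

    decode : Fin (size F * size G) → X × Y
    decode = decode-pair ∘ remQuot (size G)

    retract : ∀ p → decode (code p) ≡ p
    retract (x , y) = trans (cong decode-pair (Fin.remQuot-combine (enc F x) (enc G y)))
                            (cong₂ _,_ (dec-enc F x) (dec-enc G y))

  Maybe-finite : ∀ {X : Set} → Finite X → Finite (Maybe X)
  Maybe-finite {X} F = retract-finite to from from-to (⊎-finite ⊤-finite F)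
    where
    to : Maybe X → ⊤ ⊎ X
    to nothing  = inj₁ tt
    to (just x) = inj₂ x

    from : ⊤ ⊎ X → Maybe X
    from (inj₁ _) = nothing
    from (inj₂ x) = just x

    from-to : ∀ x → from (to x) ≡ x
    from-to nothing  = refl
    from-to (just x) = refl

  Vec-finite : ∀ {X : Set} n → Finite X → Finite (Vec X n)
  Vec-finite zero F = retract-finite (λ _ → tt) (λ _ → []) (λ { [] → refl }) ⊤-finite
  Vec-finite (suc n) F =
    retract-finite (λ { (x ∷ xs) → x , xs }) (λ { (x , xs) → x ∷ xs }) (λ { (x ∷ xs) → refl })
                   (×-finite F (Vec-finite n F))

  Move-finite : Finite Move
  Move-finite = retract-finite to from from-to (Fin-finite 3)
    where
    to : Move → Fin 3
    to left  = zero
    to stay  = suc zero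
    to right = suc (suc zero)

    from : Fin 3 → Move
    from zero             = left
    from (suc zero)       = stay
    from (suc (suc zero)) = right

    from-to : ∀ x → from (to x) ≡ x
    from-to left  = refl
    from-to stay  = refl
    from-to right = refl

  Sym-finite : ∀ n → Finite (Sym n)
  Sym-finite n = retract-finite to from from-to (Maybe-finite (Maybe-finite (Fin-finite n)))
    where
    to : Sym n → Maybe (Maybe (Fin n))
    to ⊢       = nothing
    to ⊣       = just nothing
    to (sym x) = just (just x)

    from : Maybe (Maybe (Fin n)) → Sym n
    from nothing         = ⊢
    from (just nothing)  = ⊣
    from (just (just x)) = sym x

    from-to : ∀ x → from (to x) ≡ x
    from-to ⊢       = refl
    from-to ⊣       = refl
    from-to (sym x) = refl

-- This iteration is used at two levels: for the stay moves on a single cell and for the crossings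
-- between the two factors of a concatenation.
module Reach {X E : Set} (F : Finite X) (f : X → E ⊎ X) where

  data Iter : X → E → ℕ → Set where
    now   : ∀ {x e} → f x ≡ inj₁ e → Iter x e 0
    later : ∀ {x y e k} → f x ≡ inj₂ y → Iter y e k → Iter x e (suc k)

  Iter-unique : ∀ {x e k e′ k′} → Iter x e k → Iter x e′ k′ → e ≡ e′ × k ≡ k′
  Iter-unique (now p) (now q) with refl ← trans (≡-sym p) q = refl , refl
  Iter-unique (now p) (later q _) with () ← trans (≡-sym p) q
  Iter-unique (later p _) (now q) with () ← trans (≡-sym p) q
  Iter-unique (later p i) (later q j) with refl ← trans (≡-sym p) q =
    let (e , k) = Iter-unique i j in e , cong suc k

  state : ∀ {x e k} → Iter x e k → Fin (suc k) → X
  state {x} _         zero    = x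
  state (later _ i) (suc j) = state i j

  Iter-state : ∀ {x e k} (i : Iter x e k) (j : Fin (suc k)) → Iter (state i j) e (k ∸ toℕ j)
  Iter-state i           zero    = i
  Iter-state (later _ i) (suc j) = Iter-state i j

  -- A repeated state would have two different distances to the exit.
  Iter-short : ∀ {x e k} → Iter x e k → k < size F
  Iter-short {k = k} it with size F ≤? k
  ... | no ¬p = ≰⇒> ¬p
  ... | yes p with Fin.pigeonhole (s≤s p) (enc F ∘ state it)
  ...   | i , j , i<j , eq
        with Iter-unique (Iter-state it i)
               (subst (λ y → Iter y _ _) (≡-sym (enc-injective F eq)) (Iter-state it j))
  ...     | _ , eq′ = ⊥-elim (<⇒≢ (∸-monoʳ-< i<j (≤-pred (Fin.toℕ<n j))) (≡-sym eq′))

  run : ℕ → X → Maybe E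
  continue : ℕ → E ⊎ X → Maybe E
  run zero       x = nothing
  run (suc fuel) x = continue fuel (f x)
  continue fuel (inj₁ e) = just e
  continue fuel (inj₂ y) = run fuel y

  run-sound : ∀ fuel {x e} → run fuel x ≡ just e → ∃ (Iter x e)
  run-sound (suc fuel) {x} eq with f x in fx
  ... | inj₁ e with refl ← eq = 0 , now fx
  ... | inj₂ y = let (k , i) = run-sound fuel eq in suc k , later fx i

  run-complete : ∀ {fuel x e k} → Iter x e k → k < fuel → run fuel x ≡ just e
  run-complete {suc fuel} (now fx)     _        rewrite fx = refl
  run-complete {suc fuel} (later fx i) (s≤s lt) rewrite fx = run-complete i lt

  -- By `Iter-short` this much fuel suffices for every exit, so `nothing` means that the iteration
  -- never exits.
  reach : X → Maybe E
  reach = run (size F)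

  reach-sound : ∀ {x e} → reach x ≡ just e → ∃ (Iter x e)
  reach-sound = run-sound (size F)

  reach-complete : ∀ {x e k} → Iter x e k → reach x ≡ just e
  reach-complete i = run-complete i (Iter-short i)

-- Two-way behaviour of words

data Act (Q B : Set) : Set where
  stop accept : Act Q B
  go          : Q → List B → Move → Act Q B

data Dir : Set where
  lft rgt : Dir

data Outcome (Q : Set) : Set where
  accepted : Outcome Q
  exits    : Dir → Q → Outcome Q

Dir-finite : Finite Dir
Dir-finite = retract-finite to from from-to (⊎-finite ⊤-finite ⊤-finite)
  where
  to : Dir → ⊤ ⊎ ⊤
  to lft = inj₁ tt
  to rgt = inj₂ tt

  from : ⊤ ⊎ ⊤ → Dir
  from (inj₁ _) = lft
  from (inj₂ _) = rgt

  from-to : ∀ d → from (to d) ≡ d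
  from-to lft = refl
  from-to rgt = refl

Outcome-finite : ∀ {Q} → Finite Q → Finite (Outcome Q)
Outcome-finite {Q} F = retract-finite to from from-to (Maybe-finite (×-finite Dir-finite F))
  where
  to : Outcome Q → Maybe (Dir × Q)
  to accepted    = nothing
  to (exits d q) = just (d , q)

  from : Maybe (Dir × Q) → Outcome Q
  from nothing        = accepted
  from (just (d , q)) = exits d q

  from-to : ∀ e → from (to e) ≡ e
  from-to accepted    = refl
  from-to (exits _ _) = refl

module Behaviour {Q B : Set} where

  -- A tape is a list of cells, each cell being the transition function of the machine on its letter.
  Cell : Set
  Cell = Q → Act Q B

  Tape : Set
  Tape = List Cell

  -- The head sits between the reversed tape ls and the tape rs, about to read in direction d.
  data Run : Dir → Tape → Q → Tape → List B → Outcome Q → Set where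
    outᴿ  : ∀ {ls q} → Run rgt ls q [] [] (exits rgt q)
    outᴸ  : ∀ {q rs} → Run lft [] q rs [] (exits lft q)
    turn  : ∀ {c ls q rs z e} → Run rgt ls q (c ∷ rs) z e → Run lft (c ∷ ls) q rs z e
    acc   : ∀ {c ls q rs} → c q ≡ accept → Run rgt ls q (c ∷ rs) [] accepted
    goˢ   : ∀ {c ls q q′ rs α z e} → c q ≡ go q′ α stay →
            Run rgt ls q′ (c ∷ rs) z e → Run rgt ls q (c ∷ rs) (α ++ z) e
    goᴿ   : ∀ {c ls q q′ rs α z e} → c q ≡ go q′ α right →
            Run rgt (c ∷ ls) q′ rs z e → Run rgt ls q (c ∷ rs) (α ++ z) e
    goᴸ   : ∀ {c ls q q′ rs α z e} → c q ≡ go q′ α left →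
            Run lft ls q′ (c ∷ rs) z e → Run rgt ls q (c ∷ rs) (α ++ z) e

  Run-unique : ∀ {d ls q rs z e z′ e′} → Run d ls q rs z e → Run d ls q rs z′ e′ → z ≡ z′ × e ≡ e′
  Run-unique outᴿ outᴿ = refl , refl
  Run-unique outᴸ outᴸ = refl , refl
  Run-unique (turn r) (turn s) = Run-unique r s
  Run-unique (acc p) (acc q) = refl , refl
  Run-unique (acc p) (goˢ q _) with () ← trans (≡-sym p) q
  Run-unique (acc p) (goᴿ q _) with () ← trans (≡-sym p) q
  Run-unique (acc p) (goᴸ q _) with () ← trans (≡-sym p) q
  Run-unique (goˢ p r) (acc q) with () ← trans (≡-sym p) q
  Run-unique (goˢ p r) (goˢ q s) with refl ← trans (≡-sym p) q =
    let (z , e) = Run-unique r s in cong (_ ++_) z , e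
  Run-unique (goˢ p r) (goᴿ q s) with () ← trans (≡-sym p) q
  Run-unique (goˢ p r) (goᴸ q s) with () ← trans (≡-sym p) q
  Run-unique (goᴿ p r) (acc q) with () ← trans (≡-sym p) q
  Run-unique (goᴿ p r) (goˢ q s) with () ← trans (≡-sym p) q
  Run-unique (goᴿ p r) (goᴿ q s) with refl ← trans (≡-sym p) q =
    let (z , e) = Run-unique r s in cong (_ ++_) z , e
  Run-unique (goᴿ p r) (goᴸ q s) with () ← trans (≡-sym p) q
  Run-unique (goᴸ p r) (acc q) with () ← trans (≡-sym p) q
  Run-unique (goᴸ p r) (goˢ q s) with () ← trans (≡-sym p) q
  Run-unique (goᴸ p r) (goᴿ q s) with () ← trans (≡-sym p) q
  Run-unique (goᴸ p r) (goᴸ q s) with refl ← trans (≡-sym p) q =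
    let (z , e) = Run-unique r s in cong (_ ++_) z , e

  Enter : Tape → Dir → Q → List B → Outcome Q → Set
  Enter x rgt q = Run rgt [] q x
  Enter x lft q = Run lft (reverse x) q []

  Enter-unique : ∀ x d {q z e z′ e′} → Enter x d q z e → Enter x d q z′ e′ → z ≡ z′ × e ≡ e′
  Enter-unique x rgt = Run-unique
  Enter-unique x lft = Run-unique

  infix 4 _⊑_
  _⊑_ : Tape → Tape → Set
  x ⊑ y = ∀ d {q z e} → Enter x d q z e → Enter y d q z e

  Beh : Set₁
  Beh = Dir → Q → List B → Outcome Q → Set

  -- Behaviour of a concatenation

  data Part : Set where
    one two : Part

  -- A run on two adjacent factors seen only at their common boundary: complete visits to the
  -- factors alternate. This makes the behaviour of a concatenation a function of the behaviours of
  -- its factors.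
  data Glue (U V : Beh) : Part → Dir → Q → List B → Outcome Q → Set where
    acc₁  : ∀ {d q z} → U d q z accepted → Glue U V one d q z accepted
    exit₁ : ∀ {d q z q′} → U d q z (exits lft q′) → Glue U V one d q z (exits lft q′)
    pass₁ : ∀ {d q z q′ z′ e} → U d q z (exits rgt q′) → Glue U V two rgt q′ z′ e →
            Glue U V one d q (z ++ z′) e
    acc₂  : ∀ {d q z} → V d q z accepted → Glue U V two d q z accepted
    exit₂ : ∀ {d q z q′} → V d q z (exits rgt q′) → Glue U V two d q z (exits rgt q′)
    pass₂ : ∀ {d q z q′ z′ e} → V d q z (exits lft q′) → Glue U V one lft q′ z′ e →
            Glue U V two d q (z ++ z′) e

  side : Dir → Part
  side rgt = one
  side lft = two

  Glue-mono : ∀ {U U′ V V′ : Beh} →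
    (∀ d {q z e} → U d q z e → U′ d q z e) → (∀ d {q z e} → V d q z e → V′ d q z e) →
    ∀ {p d q z e} → Glue U V p d q z e → Glue U′ V′ p d q z e
  Glue-mono f g (acc₁ r)    = acc₁ (f _ r)
  Glue-mono f g (exit₁ r)   = exit₁ (f _ r)
  Glue-mono f g (pass₁ r s) = pass₁ (f _ r) (Glue-mono f g s)
  Glue-mono f g (acc₂ r)    = acc₂ (g _ r)
  Glue-mono f g (exit₂ r)   = exit₂ (g _ r)
  Glue-mono f g (pass₂ r s) = pass₂ (g _ r) (Glue-mono f g s)

  reassoc : ∀ (α {β γ} : List B) {d ls q rs e} →
            Run d ls q rs (α ++ β ++ γ) e → Run d ls q rs ((α ++ β) ++ γ) e
  reassoc α {β} {γ} = subst (λ z → Run _ _ _ _ z _) (≡-sym (++-assoc α β γ))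

  module _ {v : Tape} where
    accˡ : ∀ {d ls q rs z} → Run d ls q rs z accepted → Run d ls q (rs ++ v) z accepted
    accˡ (turn r)  = turn (accˡ r)
    accˡ (acc p)   = acc p
    accˡ (goˢ p r) = goˢ p (accˡ r)
    accˡ (goᴿ p r) = goᴿ p (accˡ r)
    accˡ (goᴸ p r) = goᴸ p (accˡ r)

    exitˡ : ∀ {d ls q rs z q′} → Run d ls q rs z (exits lft q′) → Run d ls q (rs ++ v) z (exits lft q′)
    exitˡ outᴸ      = outᴸ
    exitˡ (turn r)  = turn (exitˡ r)
    exitˡ (goˢ p r) = goˢ p (exitˡ r)
    exitˡ (goᴿ p r) = goᴿ p (exitˡ r)
    exitˡ (goᴸ p r) = goᴸ p (exitˡ r)

    passˡ : ∀ {d ls q rs z q′ z′ e} → Run d ls q rs z (exits rgt q′) →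
            Run rgt (rs ʳ++ ls) q′ v z′ e → Run d ls q (rs ++ v) (z ++ z′) e
    passˡ outᴿ s = s
    passˡ (turn r) s = turn (passˡ r s)
    passˡ (goˢ {α = α} p r) s = reassoc α (goˢ p (passˡ r s))
    passˡ (goᴿ {α = α} p r) s = reassoc α (goᴿ p (passˡ r s))
    passˡ (goᴸ {α = α} p r) s = reassoc α (goᴸ p (passˡ r s))

  module _ {u : Tape} where
    accʳ : ∀ {d ls q rs z} → Run d ls q rs z accepted → Run d (ls ++ u) q rs z accepted
    accʳ (turn r)  = turn (accʳ r)
    accʳ (acc p)   = acc p
    accʳ (goˢ p r) = goˢ p (accʳ r)
    accʳ (goᴿ p r) = goᴿ p (accʳ r)
    accʳ (goᴸ p r) = goᴸ p (accʳ r)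

    exitʳ : ∀ {d ls q rs z q′} → Run d ls q rs z (exits rgt q′) → Run d (ls ++ u) q rs z (exits rgt q′)
    exitʳ outᴿ      = outᴿ
    exitʳ (turn r)  = turn (exitʳ r)
    exitʳ (goˢ p r) = goˢ p (exitʳ r)
    exitʳ (goᴿ p r) = goᴿ p (exitʳ r)
    exitʳ (goᴸ p r) = goᴸ p (exitʳ r)

    passʳ : ∀ {d ls q rs z q′ z′ e} → Run d ls q rs z (exits lft q′) →
            Run lft u q′ (ls ʳ++ rs) z′ e → Run d (ls ++ u) q rs (z ++ z′) e
    passʳ outᴸ s = s
    passʳ (turn r) s = turn (passʳ r s)
    passʳ (goˢ {α = α} p r) s = reassoc α (goˢ p (passʳ r s))
    passʳ (goᴿ {α = α} p r) s = reassoc α (goᴿ p (passʳ r s))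
    passʳ (goᴸ {α = α} p r) s = reassoc α (goᴸ p (passʳ r s))

  module _ (u v : Tape) where

    GlueRun : Part → Dir → Q → List B → Outcome Q → Set
    GlueRun one rgt q = Run rgt [] q (u ++ v)
    GlueRun one lft q = Run lft (reverse u) q v
    GlueRun two rgt q = Run rgt (reverse u) q v
    GlueRun two lft q = Run lft (reverse v ++ reverse u) q []

    Glue⇒Run : ∀ {p d q z e} → Glue (Enter u) (Enter v) p d q z e → GlueRun p d q z e
    Glue⇒Run {d = rgt} (acc₁ r)    = accˡ r
    Glue⇒Run {d = lft} (acc₁ r)    = accˡ r
    Glue⇒Run {d = rgt} (exit₁ r)   = exitˡ r
    Glue⇒Run {d = lft} (exit₁ r)   = exitˡ r
    Glue⇒Run {d = rgt} (pass₁ r s) = passˡ r (Glue⇒Run s)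
    Glue⇒Run {d = lft} (pass₁ r s) = passˡ r (Glue⇒Run s)
    Glue⇒Run {d = rgt} (acc₂ r)    = accʳ r
    Glue⇒Run {d = lft} (acc₂ r)    = accʳ r
    Glue⇒Run {d = rgt} (exit₂ r)   = exitʳ r
    Glue⇒Run {d = lft} (exit₂ r)   = exitʳ r
    Glue⇒Run {d = rgt} (pass₂ r s) = passʳ r (Glue⇒Run s)
    Glue⇒Run {d = lft} (pass₂ r s) =
      passʳ r (subst (λ rs → Run lft (reverse u) _ rs _ _) (≡-sym (reverse-involutive v)) (Glue⇒Run s))

    Glue⇒Enter : ∀ d {q z e} → Glue (Enter u) (Enter v) (side d) d q z e → Enter (u ++ v) d q z e
    Glue⇒Enter rgt g = Glue⇒Run g
    Glue⇒Enter lft g =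
      subst (λ ls → Run lft ls _ [] _ _) (≡-sym (reverse-++ u v)) (Glue⇒Run g)

    -- A run inside part one of u ++ v, up to the moment it first leaves that part.
    data Head₁ (d : Dir) (ls : Tape) (q : Q) (rs : Tape) : List B → Outcome Q → Set where
      acc  : ∀ {z} → Run d ls q rs z accepted → Head₁ d ls q rs z accepted
      exit : ∀ {z q′} → Run d ls q rs z (exits lft q′) → Head₁ d ls q rs z (exits lft q′)
      pass : ∀ {z q′ z′ e} → Run d ls q rs z (exits rgt q′) →
             Glue (Enter u) (Enter v) two rgt q′ z′ e → Head₁ d ls q rs (z ++ z′) e

    data Head₂ (d : Dir) (ls : Tape) (q : Q) (rs : Tape) : List B → Outcome Q → Set where
      acc  : ∀ {z} → Run d ls q rs z accepted → Head₂ d ls q rs z accepted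
      exit : ∀ {z q′} → Run d ls q rs z (exits rgt q′) → Head₂ d ls q rs z (exits rgt q′)
      pass : ∀ {z q′ z′ e} → Run d ls q rs z (exits lft q′) →
             Glue (Enter u) (Enter v) one lft q′ z′ e → Head₂ d ls q rs (z ++ z′) e

    extend₁ : ∀ {d ls q rs d′ ls′ q′ rs′} α →
      (∀ {z e} → Run d′ ls′ q′ rs′ z e → Run d ls q rs (α ++ z) e) →
      ∀ {z e} → Head₁ d′ ls′ q′ rs′ z e → Head₁ d ls q rs (α ++ z) e
    extend₁ α f (acc r)  = acc (f r)
    extend₁ α f (exit r) = exit (f r)
    extend₁ α f (pass {z = z} {z′ = z′} r g) = subst (λ x → Head₁ _ _ _ _ x _) (++-assoc α z z′) (pass (f r) g)

    extend₂ : ∀ {d ls q rs d′ ls′ q′ rs′} α →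
      (∀ {z e} → Run d′ ls′ q′ rs′ z e → Run d ls q rs (α ++ z) e) →
      ∀ {z e} → Head₂ d′ ls′ q′ rs′ z e → Head₂ d ls q rs (α ++ z) e
    extend₂ α f (acc r)  = acc (f r)
    extend₂ α f (exit r) = exit (f r)
    extend₂ α f (pass {z = z} {z′ = z′} r g) = subst (λ x → Head₂ _ _ _ _ x _) (++-assoc α z z′) (pass (f r) g)

    close₁ : ∀ {d ls q rs} → (∀ {z e} → Run d ls q rs z e → Enter u d q z e) →
             ∀ {z e} → Head₁ d ls q rs z e → Glue (Enter u) (Enter v) one d q z e
    close₁ f (acc r)    = acc₁ (f r)
    close₁ f (exit r)   = exit₁ (f r)
    close₁ f (pass r g) = pass₁ (f r) g

    close₂ : ∀ {d ls q rs} → (∀ {z e} → Run d ls q rs z e → Enter v d q z e) →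
             ∀ {z e} → Head₂ d ls q rs z e → Glue (Enter u) (Enter v) two d q z e
    close₂ f (acc r)    = acc₂ (f r)
    close₂ f (exit r)   = exit₂ (f r)
    close₂ f (pass r g) = pass₂ (f r) g

    -- The equation places the head anywhere inside the factor, so the induction can follow the run
    -- step by step. When the head reaches the boundary, the same run is handed to the other factor.
    head₁ᴿ : ∀ ls {q} rs {z e} → rs ʳ++ ls ≡ reverse u → Run rgt ls q (rs ++ v) z e → Head₁ rgt ls q rs z e
    head₁ᴸ : ∀ ls {q} rs {z e} → rs ʳ++ ls ≡ reverse u → Run lft ls q (rs ++ v) z e → Head₁ lft ls q rs z e
    head₂ᴿ : ∀ ls {q} rs {z e} → ls ʳ++ rs ≡ v → Run rgt (ls ++ reverse u) q rs z e → Head₂ rgt ls q rs z e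
    head₂ᴸ : ∀ ls {q} rs {z e} → ls ʳ++ rs ≡ v → Run lft (ls ++ reverse u) q rs z e → Head₂ lft ls q rs z e

    head₁ᴿ ls []       refl r                  = pass outᴿ (close₂ id (head₂ᴿ [] v refl r))
    head₁ᴿ ls (c ∷ rs) eq   (acc p)            = acc (acc p)
    head₁ᴿ ls (c ∷ rs) eq   (goˢ {α = α} p r) = extend₁ α (goˢ p) (head₁ᴿ ls (c ∷ rs) eq r)
    head₁ᴿ ls (c ∷ rs) eq   (goᴿ {α = α} p r) = extend₁ α (goᴿ p) (head₁ᴿ (c ∷ ls) rs eq r)
    head₁ᴿ ls (c ∷ rs) eq   (goᴸ {α = α} p r) = extend₁ α (goᴸ p) (head₁ᴸ ls (c ∷ rs) eq r)

    head₁ᴸ []       rs eq outᴸ     = exit outᴸ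
    head₁ᴸ (c ∷ ls) rs eq (turn r) = extend₁ [] turn (head₁ᴿ ls (c ∷ rs) eq r)

    head₂ᴿ ls []       eq outᴿ              = exit outᴿ
    head₂ᴿ ls (c ∷ rs) eq (acc p)            = acc (acc p)
    head₂ᴿ ls (c ∷ rs) eq (goˢ {α = α} p r) = extend₂ α (goˢ p) (head₂ᴿ ls (c ∷ rs) eq r)
    head₂ᴿ ls (c ∷ rs) eq (goᴿ {α = α} p r) = extend₂ α (goᴿ p) (head₂ᴿ (c ∷ ls) rs eq r)
    head₂ᴿ ls (c ∷ rs) eq (goᴸ {α = α} p r) = extend₂ α (goᴸ p) (head₂ᴸ ls (c ∷ rs) eq r)

    head₂ᴸ []       rs refl r        = pass outᴸ (close₁ id (head₁ᴸ (reverse u) [] refl r))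
    head₂ᴸ (c ∷ ls) rs eq   (turn r) = extend₂ [] turn (head₂ᴿ ls (c ∷ rs) eq r)

    Enter⇒Glue : ∀ d {q z e} → Enter (u ++ v) d q z e → Glue (Enter u) (Enter v) (side d) d q z e
    Enter⇒Glue rgt r = close₁ id (head₁ᴿ [] u refl r)
    Enter⇒Glue lft r = close₂ id (head₂ᴸ (reverse v) [] (reverse-involutive v)
      (subst (λ ls → Run lft ls _ [] _ _) (reverse-++ u v) r))

  ⊑-refl : ∀ {x} → x ⊑ x
  ⊑-refl d r = r

  ⊑-trans : ∀ {x y z} → x ⊑ y → y ⊑ z → x ⊑ z
  ⊑-trans f g d r = g d (f d r)

  ⊑-++ : ∀ {x x′ y y′} → x ⊑ x′ → y ⊑ y′ → x ++ y ⊑ x′ ++ y′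
  ⊑-++ {x} {x′} {y} {y′} f g d r = Glue⇒Enter x′ y′ d (Glue-mono f g (Enter⇒Glue x y d r))

  ⊑-reflexive : ∀ {x y} → x ≡ y → x ⊑ y
  ⊑-reflexive refl = ⊑-refl

  -- Distributing the output of a run over copies of its tape

  data Tri : Act Q B → Act Q B → Act Q B → Set where
    stop   : Tri stop stop stop
    accept : Tri accept accept accept
    goˡ    : ∀ {q α m} → Tri (go q α m) (go q α m) (go q [] m)
    goʳ    : ∀ {q α m} → Tri (go q α m) (go q [] m) (go q α m)

  -- The output of the first tape is shared out, cell by cell, between the other two.
  data Shared : Tape → Tape → Tape → Set where
    []  : Shared [] [] []
    _∷_ : ∀ {c c₁ c₂ x x₁ x₂} → (∀ q → Tri (c q) (c₁ q) (c₂ q)) → Shared x x₁ x₂ →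
          Shared (c ∷ x) (c₁ ∷ x₁) (c₂ ∷ x₂)

  Shared-++ : ∀ {x x₁ x₂ y y₁ y₂} → Shared x x₁ x₂ → Shared y y₁ y₂ → Shared (x ++ y) (x₁ ++ y₁) (x₂ ++ y₂)
  Shared-++ []      t = t
  Shared-++ (c ∷ s) t = c ∷ Shared-++ s t

  Shared-ʳ++ : ∀ {x x₁ x₂ y y₁ y₂} → Shared x x₁ x₂ → Shared y y₁ y₂ → Shared (x ʳ++ y) (x₁ ʳ++ y₁) (x₂ ʳ++ y₂)
  Shared-ʳ++ []      t = t
  Shared-ʳ++ (c ∷ s) t = Shared-ʳ++ s (c ∷ t)

  silent : Act Q B → Act Q B
  silent stop       = stop
  silent accept     = accept
  silent (go q α m) = go q [] m

  quiet : Tape → Tape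
  quiet = map (silent ∘_)

  share₁ : ∀ x → Shared x x (quiet x)
  share₁ []      = []
  share₁ (c ∷ x) = tri ∷ share₁ x
    where
    tri : ∀ q → Tri (c q) (c q) (silent (c q))
    tri q with c q
    ... | stop     = stop
    ... | accept   = accept
    ... | go _ _ _ = goˡ

  share₂ : ∀ x → Shared x (quiet x) x
  share₂ []      = []
  share₂ (c ∷ x) = tri ∷ share₂ x
    where
    tri : ∀ q → Tri (c q) (silent (c q)) (c q)
    tri q with c q
    ... | stop     = stop
    ... | accept   = accept
    ... | go _ _ _ = goʳ

  share₀ : ∀ x → Shared (quiet x) (quiet x) (quiet x)
  share₀ []      = []
  share₀ (c ∷ x) = tri ∷ share₀ x
    where
    tri : ∀ q → Tri (silent (c q)) (silent (c q)) (silent (c q))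
    tri q with c q
    ... | stop     = stop
    ... | accept   = accept
    ... | go _ _ _ = goˡ

  -- The word `z` is a shuffle of `z₁` and `z₂`. Pumping uses only that lengths add up, and cutting
  -- only that an empty first share leaves everything to the second.
  record Shares (z z₁ z₂ : List B) : Set where
    constructor shares
    field
      total : length z ≡ length z₁ + length z₂
      only₂ : z₁ ≡ [] → z ≡ z₂

  Shares-∷ˡ : ∀ α {z z₁ z₂} → Shares z z₁ z₂ → Shares (α ++ z) (α ++ z₁) z₂
  Shares-∷ˡ α {z} {z₁} {z₂} (shares t o) = shares
    (trans (length-++ α) (trans (cong (length α +_) t)
      (trans (≡-sym (+-assoc (length α) _ _)) (cong (_+ length z₂) (≡-sym (length-++ α))))))
    (only α)
    where
    only : ∀ α → α ++ z₁ ≡ [] → α ++ z ≡ z₂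
    only [] eq = o eq

  Shares-∷ʳ : ∀ α {z z₁ z₂} → Shares z z₁ z₂ → Shares (α ++ z) z₁ (α ++ z₂)
  Shares-∷ʳ α {z} {z₁} {z₂} (shares t o) = shares
    (trans (length-++ α) (trans (cong (length α +_) t)
      (trans (swap (length α) (length z₁) (length z₂)) (cong (length z₁ +_) (≡-sym (length-++ α))))))
    (cong (α ++_) ∘ o)
    where
    swap : ∀ a b c → a + (b + c) ≡ b + (a + c)
    swap a b c = trans (≡-sym (+-assoc a b c)) (trans (cong (_+ c) (+-comm a b)) (+-assoc b a c))

  SharedRun : Dir → Tape → Q → Tape → Dir → Tape → Q → Tape → List B → Outcome Q → Set
  SharedRun d ls q rs d′ ls′ q′ rs′ z e =
    ∃₂ λ z₁ z₂ → Run d ls q rs z₁ e × Run d′ ls′ q′ rs′ z₂ e × Shares z z₁ z₂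

  Tri-go : ∀ {a a₁ a₂ q α m} → Tri a a₁ a₂ → a ≡ go q α m → ∃₂ λ α₁ α₂ →
           a₁ ≡ go q α₁ m × a₂ ≡ go q α₂ m × (∀ {z z₁ z₂} → Shares z z₁ z₂ → Shares (α ++ z) (α₁ ++ z₁) (α₂ ++ z₂))
  Tri-go goˡ refl = _ , _ , refl , refl , Shares-∷ˡ _
  Tri-go goʳ refl = _ , _ , refl , refl , Shares-∷ʳ _

  Tri-accept : ∀ {a a₁ a₂} → Tri a a₁ a₂ → a ≡ accept → a₁ ≡ accept × a₂ ≡ accept
  Tri-accept accept refl = refl , refl

  Tri-go₁ : ∀ {a a₁ a₂ q α₁ m} → Tri a a₁ a₂ → a₁ ≡ go q α₁ m → ∃ λ α → a ≡ go q α m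
  Tri-go₁ goˡ refl = _ , refl
  Tri-go₁ goʳ refl = _ , refl

  Tri-accept₁ : ∀ {a a₁ a₂} → Tri a a₁ a₂ → a₁ ≡ accept → a ≡ accept
  Tri-accept₁ accept refl = refl

  -- Output never influences a transition, so the three heads move in step and only the emitted
  -- words differ.
  distribute : ∀ {d ls ls₁ ls₂ q rs rs₁ rs₂ z e} → Shared ls ls₁ ls₂ → Shared rs rs₁ rs₂ →
               Run d ls q rs z e → SharedRun d ls₁ q rs₁ d ls₂ q rs₂ z e
  distribute l [] outᴿ = [] , [] , outᴿ , outᴿ , shares refl id
  distribute [] r outᴸ = [] , [] , outᴸ , outᴸ , shares refl id
  distribute (c ∷ l) r (turn s) =
    let (z₁ , z₂ , s₁ , s₂ , h) = distribute l (c ∷ r) s in z₁ , z₂ , turn s₁ , turn s₂ , h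
  distribute l (t ∷ r) (acc p) =
    let (p₁ , p₂) = Tri-accept (t _) p in [] , [] , acc p₁ , acc p₂ , shares refl id
  distribute l (t ∷ r) (goˢ p s) =
    let (_ , _ , p₁ , p₂ , f) = Tri-go (t _) p
        (_ , _ , s₁ , s₂ , h) = distribute l (t ∷ r) s
    in _ , _ , goˢ p₁ s₁ , goˢ p₂ s₂ , f h
  distribute l (t ∷ r) (goᴿ p s) =
    let (_ , _ , p₁ , p₂ , f) = Tri-go (t _) p
        (_ , _ , s₁ , s₂ , h) = distribute (t ∷ l) r s
    in _ , _ , goᴿ p₁ s₁ , goᴿ p₂ s₂ , f h
  distribute l (t ∷ r) (goᴸ p s) =
    let (_ , _ , p₁ , p₂ , f) = Tri-go (t _) p
        (_ , _ , s₁ , s₂ , h) = distribute l (t ∷ r) s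
    in _ , _ , goᴸ p₁ s₁ , goᴸ p₂ s₂ , f h

  -- The way back: after a factor has been exchanged on a partly silent tape, this restores the
  -- missing outputs. Which word is then produced is found by distributing again and comparing by
  -- determinism.
  recover : ∀ {d ls ls₁ ls₂ q rs rs₁ rs₂ z e} → Shared ls ls₁ ls₂ → Shared rs rs₁ rs₂ →
            Run d ls₁ q rs₁ z e → ∃ λ z′ → Run d ls q rs z′ e
  recover l [] outᴿ = _ , outᴿ
  recover [] r outᴸ = _ , outᴸ
  recover (c ∷ l) r (turn s)    = _ , turn (proj₂ (recover l (c ∷ r) s))
  recover l (t ∷ r) (acc p)     = _ , acc (Tri-accept₁ (t _) p)
  recover l (t ∷ r) (goˢ p s)  = _ , goˢ (proj₂ (Tri-go₁ (t _) p)) (proj₂ (recover l (t ∷ r) s))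
  recover l (t ∷ r) (goᴿ p s) = _ , goᴿ (proj₂ (Tri-go₁ (t _) p)) (proj₂ (recover (t ∷ l) r s))
  recover l (t ∷ r) (goᴸ p s) = _ , goᴸ (proj₂ (Tri-go₁ (t _) p)) (proj₂ (recover l (t ∷ r) s))

  Enter-distribute : ∀ {x x₁ x₂} d {q z e} → Shared x x₁ x₂ → Enter x d q z e →
                     ∃₂ λ z₁ z₂ → Enter x₁ d q z₁ e × Enter x₂ d q z₂ e × Shares z z₁ z₂
  Enter-distribute rgt s r = distribute [] s r
  Enter-distribute lft s r = distribute (Shared-ʳ++ s []) [] r

  Enter-recover : ∀ {x x₁ x₂} d {q z e} → Shared x x₁ x₂ → Enter x₁ d q z e → ∃ λ z′ → Enter x d q z′ e
  Enter-recover rgt s r = recover [] s r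
  Enter-recover lft s r = recover (Shared-ʳ++ s []) [] r

  -- A quiet tape can be shared between two copies of itself. By determinism both copies output `z`
  -- as well, so the length of `z` is twice itself.
  quiet-output : ∀ x d {q z e} → Enter (quiet x) d q z e → z ≡ []
  quiet-output x d {z = z} r with Enter-distribute d (share₀ x) r
  ... | z₁ , z₂ , r₁ , r₂ , shares total _
      with refl ← proj₁ (Enter-unique (quiet x) d r r₁)
         | refl ← proj₁ (Enter-unique (quiet x) d r r₂) = double-empty z total
    where
    double-empty : ∀ (z : List B) → length z ≡ length z + length z → z ≡ []
    double-empty []      _  = refl
    double-empty (b ∷ z) eq = ⊥-elim (m+1+n≢m (length (b ∷ z)) (≡-sym eq))

  silence : ∀ x d {q z e} → Enter x d q z e → Enter (quiet x) d q [] e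
  silence x d r with Enter-distribute d (share₁ x) r
  ... | _ , _ , _ , r₂ , _ with refl ← quiet-output x d r₂ = r₂

-- Behaviours as finite tables

module Tables {Q B : Set} (F : Finite Q) where
  open Behaviour {Q} {B}

  Tbl : Set
  Tbl = Dir → Q → Maybe (Outcome Q)

  -- A behaviour is only a relation. To be coded in a finite type it has to be decided, with
  -- `nothing` where no outcome exists because the machine stops or runs forever.
  record Describes (t : Tbl) (U : Beh) : Set where
    field
      sound    : ∀ d {q e} → t d q ≡ just e → ∃ λ z → U d q z e
      complete : ∀ d {q z e} → U d q z e → t d q ≡ just e

  open Describes

  module _ (c : Cell) where
    stepCell : Q → Maybe (Outcome Q) ⊎ Q
    stepCell q with c q
    ... | stop          = inj₁ nothing
    ... | accept        = inj₁ (just accepted)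
    ... | go q′ _ stay  = inj₂ q′
    ... | go q′ _ left  = inj₁ (just (exits lft q′))
    ... | go q′ _ right = inj₁ (just (exits rgt q′))

    open Reach F stepCell

    cellTable : Tbl
    -- The direction is irrelevant: on a single cell both entries start by reading that cell.
    cellTable d q = Maybe.maybe id nothing (reach q)

    cell-sound : ∀ {q e k} → Iter q (just e) k → ∃ λ z → Run rgt [] q (c ∷ []) z e
    cell-sound {q} (now p) with c q in eq
    ... | accept        with refl ← p = _ , acc eq
    ... | go q′ _ left  with refl ← p = _ , goᴸ eq outᴸ
    ... | go q′ _ right with refl ← p = _ , goᴿ eq outᴿ
    cell-sound {q} (later p i) with c q in eq
    ... | go q′ _ stay with refl ← p = _ , goˢ eq (proj₂ (cell-sound i))

    cell-complete : ∀ {q z e} → Run rgt [] q (c ∷ []) z e → ∃ (Iter q (just e))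
    cell-complete {q} (acc p) = 0 , now (h p)
      where
      h : c q ≡ accept → stepCell q ≡ inj₁ (just accepted)
      h p rewrite p = refl
    cell-complete {q} (goᴸ {q′ = q′} {α = α} p outᴸ) = 0 , now (h p)
      where
      h : c q ≡ go q′ α left → stepCell q ≡ inj₁ (just (exits lft q′))
      h p rewrite p = refl
    cell-complete {q} (goᴿ {q′ = q′} {α = α} p outᴿ) = 0 , now (h p)
      where
      h : c q ≡ go q′ α right → stepCell q ≡ inj₁ (just (exits rgt q′))
      h p rewrite p = refl
    cell-complete {q} (goˢ {q′ = q′} {α = α} p r) = _ , later (h p) (proj₂ (cell-complete r))
      where
      h : c q ≡ go q′ α stay → stepCell q ≡ inj₂ q′
      h p rewrite p = refl

    cell-describes : Describes cellTable (Enter (c ∷ []))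
    sound cell-describes d {q} eq with reach q in eq′
    sound cell-describes rgt refl | just (just e) = cell-sound (proj₂ (reach-sound eq′))
    sound cell-describes lft refl | just (just e) =
      let (z , r) = cell-sound (proj₂ (reach-sound eq′)) in z , turn r
    complete cell-describes rgt r rewrite reach-complete (proj₂ (cell-complete r)) = refl
    complete cell-describes lft (turn r) rewrite reach-complete (proj₂ (cell-complete r)) = refl

  Part-finite : Finite Part
  Part-finite = retract-finite to from from-to Dir-finite
    where
    to : Part → Dir
    to one = lft
    to two = rgt

    from : Dir → Part
    from lft = one
    from rgt = two

    from-to : ∀ p → from (to p) ≡ p
    from-to one = refl
    from-to two = refl

  module _ (t₁ t₂ : Tbl) where
    Node : Set
    Node = Part × Dir × Q

    after₁ after₂ : Maybe (Outcome Q) → Maybe (Outcome Q) ⊎ Node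
    after₁ nothing              = inj₁ nothing
    after₁ (just accepted)      = inj₁ (just accepted)
    after₁ (just (exits lft q)) = inj₁ (just (exits lft q))
    after₁ (just (exits rgt q)) = inj₂ (two , rgt , q)
    after₂ nothing              = inj₁ nothing
    after₂ (just accepted)      = inj₁ (just accepted)
    after₂ (just (exits rgt q)) = inj₁ (just (exits rgt q))
    after₂ (just (exits lft q)) = inj₂ (one , lft , q)

    stepGlue : Node → Maybe (Outcome Q) ⊎ Node
    stepGlue (one , d , q) = after₁ (t₁ d q)
    stepGlue (two , d , q) = after₂ (t₂ d q)

    open Reach (×-finite Part-finite (×-finite Dir-finite F)) stepGlue

    glueTable : Tbl
    glueTable d q = Maybe.maybe id nothing (reach (side d , d , q))

    module _ {U V : Beh} (D₁ : Describes t₁ U) (D₂ : Describes t₂ V) where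

      glue-sound : ∀ {p d q e k} → Iter (p , d , q) (just e) k → ∃ λ z → Glue U V p d q z e
      glue-sound {one} {d} {q} (now eq) with t₁ d q in eq′
      ... | just accepted      with refl ← eq = _ , acc₁ (proj₂ (sound D₁ d eq′))
      ... | just (exits lft _) with refl ← eq = _ , exit₁ (proj₂ (sound D₁ d eq′))
      glue-sound {two} {d} {q} (now eq) with t₂ d q in eq′
      ... | just accepted      with refl ← eq = _ , acc₂ (proj₂ (sound D₂ d eq′))
      ... | just (exits rgt _) with refl ← eq = _ , exit₂ (proj₂ (sound D₂ d eq′))
      glue-sound {one} {d} {q} (later eq i) with t₁ d q in eq′
      ... | just (exits rgt _) with refl ← eq =
            _ , pass₁ (proj₂ (sound D₁ d eq′)) (proj₂ (glue-sound i))
      glue-sound {two} {d} {q} (later eq i) with t₂ d q in eq′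
      ... | just (exits lft _) with refl ← eq =
            _ , pass₂ (proj₂ (sound D₂ d eq′)) (proj₂ (glue-sound i))

      glue-complete : ∀ {p d q z e} → Glue U V p d q z e → ∃ (Iter (p , d , q) (just e))
      glue-complete (acc₁ r)    = _ , now (cong after₁ (complete D₁ _ r))
      glue-complete (exit₁ r)   = _ , now (cong after₁ (complete D₁ _ r))
      glue-complete (pass₁ r g) = _ , later (cong after₁ (complete D₁ _ r)) (proj₂ (glue-complete g))
      glue-complete (acc₂ r)    = _ , now (cong after₂ (complete D₂ _ r))
      glue-complete (exit₂ r)   = _ , now (cong after₂ (complete D₂ _ r))
      glue-complete (pass₂ r g) = _ , later (cong after₂ (complete D₂ _ r)) (proj₂ (glue-complete g))

      glue-describes : Describes glueTable (λ d → Glue U V (side d) d)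
      sound glue-describes d {q} eq with reach (side d , d , q) in eq′
      sound glue-describes d refl | just (just e) = glue-sound (proj₂ (reach-sound eq′))
      complete glue-describes d r rewrite reach-complete (proj₂ (glue-complete r)) = refl

  table : Tape → Tbl
  table []      d q = just (exits d q)
  table (c ∷ x)     = glueTable (cellTable c) (table x)

  table-describes : ∀ x → Describes (table x) (Enter x)
  sound    (table-describes [])      rgt refl = _ , outᴿ
  sound    (table-describes [])      lft refl = _ , outᴸ
  complete (table-describes [])      rgt outᴿ = refl
  complete (table-describes [])      lft outᴸ = refl
  sound    (table-describes (c ∷ x)) d eq =
    let (z , g) = sound (glue-describes _ _ (cell-describes c) (table-describes x)) d eq
    in z , Glue⇒Enter (c ∷ []) x d g
  complete (table-describes (c ∷ x)) d r =
    complete (glue-describes _ _ (cell-describes c) (table-describes x)) d (Enter⇒Glue (c ∷ []) x d r)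

  abstract
    entry-finite : Finite (Dir × Q)
    entry-finite = ×-finite Dir-finite F

    Code-finite : Finite (Vec (Maybe (Outcome Q)) (size entry-finite))
    Code-finite = Vec-finite (size entry-finite) (Maybe-finite (Outcome-finite F))

    classes : ℕ
    classes = size Code-finite

    entries : Tape → Fin (size entry-finite) → Maybe (Outcome Q)
    entries x i = table (quiet x) (proj₁ (dec entry-finite i)) (proj₂ (dec entry-finite i))

    -- The two-way behaviour of a word, with all outputs forgotten.
    class : Tape → Fin classes
    class x = enc Code-finite (tabulate (entries x))

    class-table : ∀ {x y} → class x ≡ class y → ∀ d q → table (quiet x) d q ≡ table (quiet y) d q
    class-table {x} {y} eq d q =
      subst (λ p → table (quiet x) (proj₁ p) (proj₂ p) ≡ table (quiet y) (proj₁ p) (proj₂ p))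
        (dec-enc entry-finite (d , q))
        (trans (≡-sym (lookup∘tabulate (entries x) i))
          (trans (cong (λ v → lookup v i) (enc-injective Code-finite eq)) (lookup∘tabulate (entries y) i)))
      where
      i : Fin (size entry-finite)
      i = enc entry-finite (d , q)

    -- Tables record outcomes but no outputs; on quiet tapes every output is empty, so nothing is
    -- lost.
    class-⊑ : ∀ {x y} → class x ≡ class y → quiet x ⊑ quiet y
    class-⊑ {x} {y} eq d {q} r
      with refl ← quiet-output x d r
      with sound (table-describes (quiet y)) d
             (trans (≡-sym (class-table {x} {y} eq d q)) (complete (table-describes (quiet x)) d r))
    ... | z , s with refl ← quiet-output y d s = s

-- Pumping and cutting tapes

module Pumping {Q B : Set} (q₀ : Q) where
  open Behaviour {Q} {B}

  Acc : Tape → List B → Set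
  Acc x z = Enter x rgt q₀ z accepted

  Acc-⊑ : ∀ {x y z} → x ⊑ y → Acc x z → Acc y z
  Acc-⊑ f = f rgt

  Acc-unique : ∀ {x z z′} → Acc x z → Acc x z′ → z ≡ z′
  Acc-unique r s = proj₁ (Run-unique r s)

  infix 4 _⊑?_
  -- Inclusion of behaviours with outputs erased: the relation that equality of classes yields.
  _⊑?_ : Tape → Tape → Set
  x ⊑? y = quiet x ⊑ quiet y

  ⊑?-++ : ∀ {x x′ y y′} → x ⊑? x′ → y ⊑? y′ → x ++ y ⊑? x′ ++ y′
  ⊑?-++ {x} {x′} {y} {y′} f g = ⊑-trans (⊑-reflexive (map-++ _ x y))
    (⊑-trans (⊑-++ f g) (⊑-reflexive (≡-sym (map-++ _ x′ y′))))

  pow : ℕ → Tape → Tape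
  pow zero    u = []
  pow (suc n) u = u ++ pow n u

  module _ {p u y : Tape} (p⊑ : p ⊑? p ++ u) (y⊑ : y ⊑? u ++ y) (⊑y : u ++ y ⊑? y) where

    y⊑pow : ∀ n → y ⊑? pow n u ++ y
    y⊑pow zero    = ⊑-refl
    y⊑pow (suc n) = ⊑-trans y⊑ (⊑-trans (⊑?-++ {u} ⊑-refl (y⊑pow n))
      (⊑-reflexive (cong quiet (≡-sym (++-assoc u (pow n u) y)))))

    module _ {z z₁} (r : Acc (p ++ u ++ y) z) (r₁ : Acc (quiet p ++ u ++ quiet y) z₁) where

      -- By the congruences, every copy of u contributes the same output z₁.
      pump-quiet : ∀ n → ∃ λ z → Acc (quiet p ++ pow n u ++ quiet y) z × n * length z₁ ≤ length z
      pump-quiet zero = [] , Acc-⊑ (⊑-trans (⊑-reflexive (map-++ _ p (u ++ y))) (⊑-++ ⊑-refl ⊑y)) (silence (p ++ u ++ y) rgt r) , z≤n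
      pump-quiet (suc n) with pump-quiet n
      ... | zₙ , s , le = z′ , subst (λ x → Acc (quiet p ++ x) z′) (≡-sym (++-assoc u (pow n u) (quiet y))) t , longer
        where
        -- One share silences the new copy of `u`, and `quiet p` absorbs it, which leaves the case
        -- `n`. The other silences the old copies, and `quiet y` absorbs them, which leaves the run
        -- `r₁` of a single `u`.
        sh : Shared (quiet p ++ u ++ pow n u ++ quiet y) (quiet p ++ quiet u ++ pow n u ++ quiet y)
                    (quiet p ++ u ++ quiet (pow n u) ++ quiet y)
        sh = Shared-++ (share₀ p) (Shared-++ (share₂ u) (Shared-++ (share₁ (pow n u)) (share₀ y)))

        s′ : Acc (quiet p ++ quiet u ++ pow n u ++ quiet y) zₙ
        s′ = Acc-⊑ (⊑-trans (⊑-++ (⊑-trans p⊑ (⊑-reflexive (map-++ _ p u))) ⊑-refl)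
               (⊑-reflexive (++-assoc (quiet p) (quiet u) (pow n u ++ quiet y)))) s
        r₁′ : Acc (quiet p ++ u ++ quiet (pow n u) ++ quiet y) z₁
        r₁′ = Acc-⊑ (⊑-++ {quiet p} ⊑-refl (⊑-++ {u} ⊑-refl
                (⊑-trans (y⊑pow n) (⊑-reflexive (map-++ _ (pow n u) y))))) r₁

        recovered = Enter-recover rgt sh s′
        z′ = proj₁ recovered
        t = proj₂ recovered

        longer : suc n * length z₁ ≤ length z′
        longer with Enter-distribute rgt sh t
        ... | _ , _ , t₁ , t₂ , shares total _
            with refl ← Acc-unique t₁ s′ | refl ← Acc-unique t₂ r₁′ =
              ≤-trans (+-monoʳ-≤ (length z₁) le)
                (≤-reflexive (trans (+-comm (length z₁) (length zₙ)) (≡-sym total)))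

      module _ {b} (bound : ∀ n {z} → Acc (p ++ pow n u ++ y) z → length z ≤ b) where

        -- The pumped run has `p` and `y` silenced, whereas the bound speaks of the real tape.
        -- Restoring their outputs can only lengthen the word.
        pump-bound : ∀ n → n * length z₁ ≤ b
        pump-bound n with pump-quiet n
        ... | z′ , s , le
            with Enter-recover rgt sh s
          where
          sh = Shared-++ (share₂ p) (Shared-++ (share₁ (pow n u)) (share₂ y))
        ...   | z″ , t
            with Enter-distribute rgt (Shared-++ (share₂ p) (Shared-++ (share₁ (pow n u)) (share₂ y))) t
        ...     | _ , _ , t₁ , _ , shares total _
            with refl ← Acc-unique t₁ s =
              ≤-trans le (≤-trans (≤-trans (m≤m+n _ _) (≤-reflexive (≡-sym total))) (bound n t))

        pump-silent : z₁ ≡ []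
        -- With `suc b` copies, even a single letter in `z₁` would exceed the bound `b`.
        pump-silent = empty z₁ (pump-bound (suc b))
          where
          empty : ∀ (z : List B) → suc b * length z ≤ b → z ≡ []
          empty []      _  = refl
          empty (x ∷ z) le = ⊥-elim (<-irrefl refl (≤-trans (m≤m*n (suc b) (suc (length z))) le))

  module _ {b a u v y} (a⊑u : a ⊑? a ++ u) (a⊑uv : a ⊑? a ++ u ++ v)
           (y⊑uvy : y ⊑? u ++ v ++ y) (uvy⊑y : u ++ v ++ y ⊑? y)
           (y⊑vy : y ⊑? v ++ y) (vy⊑y : v ++ y ⊑? y) (uv⊑u : u ++ v ⊑? u)
           (boundᵤ : ∀ n {z} → Acc (a ++ pow n u ++ y) z → length z ≤ b)
           (boundᵤᵥ : ∀ n {z} → Acc (a ++ pow n (u ++ v) ++ y) z → length z ≤ b) where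

    assoc : ∀ {x} → Acc (a ++ u ++ v ++ y) x → Acc (a ++ (u ++ v) ++ y) x
    assoc {x} = subst (λ t → Acc (a ++ t) x) (≡-sym (++-assoc u v y))

    -- Both u ++ v and u are silent in this context, and then they are interchangeable.
    cut-tape : ∀ {z} → Acc (a ++ u ++ v ++ y) z → Acc (a ++ u ++ y) z
    cut-tape {z} r with Enter-distribute rgt (Shared-++ (share₂ a) (Shared-++ (share₁ (u ++ v)) (share₂ y))) (assoc r)
    ... | z₁ , z₂ , r₁ , r₂ , shares _ only
        with refl ← pump-silent {p = a} {u ++ v} {y} a⊑uv
                      (⊑-trans y⊑uvy (⊑-reflexive (cong quiet (≡-sym (++-assoc u v y)))))
                      (⊑-trans (⊑-reflexive (cong quiet (++-assoc u v y))) uvy⊑y)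
                      (assoc r) r₁ boundᵤᵥ
        -- Now `z` is also the output of the tape with `u ++ v` silenced. On that tape equality of
        -- behaviours puts quiet `u` in place of quiet `u ++ v`, and `recover` makes `u` loud again.
        with refl ← only refl
        with Enter-recover rgt (Shared-++ (share₁ a) (Shared-++ (share₂ u) (share₁ y)))
               (Acc-⊑ (⊑-++ {a} ⊑-refl (⊑-++ uv⊑u (⊑-refl {y}))) r₂)
    ... | z′ , s
        with Enter-distribute rgt (Shared-++ (share₂ a) (Shared-++ (share₁ u) (share₂ y))) s
    ... | z₃ , z₄ , s₁ , s₂ , shares _ only′
        -- Making `u` loud could have added output; pumping `u` on its own excludes this.
        with refl ← pump-silent {p = a} {u} {y} a⊑u
                      (⊑-trans y⊑uvy (⊑?-++ {u} ⊑-refl vy⊑y))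
                      (⊑-trans (⊑?-++ {u} ⊑-refl y⊑vy) uvy⊑y)
                      s s₁ boundᵤ
        with refl ← only′ refl
        with refl ← Acc-unique s₂ (Acc-⊑ (⊑-++ {a} ⊑-refl (⊑-++ uv⊑u (⊑-refl {y}))) r₂) = s

-- Bounding the number of visits

-- Two indices j < l of equal colour that look alike from the first index i of that colour.
module Pigeonhole {k₁ k₂ : ℕ} (g : ℕ → Fin k₁) (h : ℕ → ℕ → Fin k₂) where

  -- If no index up to `n` has colour `x`, the value is `n` itself, so testing the colour of the
  -- value tells whether the search has succeeded.
  first : Fin k₁ → ℕ → ℕ
  first x zero = zero
  first x (suc n) with g (first x n) Fin.≟ x
  ... | yes _ = first x n
  ... | no  _ = suc n

  first-≤ : ∀ x n → first x n ≤ n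
  first-≤ x zero = z≤n
  first-≤ x (suc n) with g (first x n) Fin.≟ x
  ... | yes _ = m≤n⇒m≤1+n (first-≤ x n)
  ... | no  _ = ≤-refl

  first-least : ∀ x n {j} → j ≤ n → g j ≡ x → g (first x n) ≡ x × first x n ≤ j
  first-least x zero z≤n eq = eq , z≤n
  first-least x (suc n) {j} le eq with g (first x n) Fin.≟ x
  ... | yes p with j ≤? n
  ...   | yes j≤n = first-least x n j≤n eq
  ...   | no  j≰n = p , ≤-trans (first-≤ x n) (<⇒≤ (≰⇒> j≰n))
  first-least x (suc n) {j} le eq | no ¬p with j ≤? n
  ...   | yes j≤n = ⊥-elim (¬p (proj₁ (first-least x n j≤n eq)))
  ...   | no  j≰n with refl ← ≤-antisym le (≰⇒> j≰n) = eq , ≤-refl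

  N : ℕ
  N = k₁ * k₂

  -- Indices that agree in `g` have the same first index, so their values of `h` are measured from a
  -- common point. A plain pigeonhole with `k₁ * k₂` colours then replaces Ramsey's theorem; the
  -- price is that `i` and `j` may coincide.
  colour : Fin (suc N) → Fin N
  colour j = combine (g (toℕ j)) (h (first (g (toℕ j)) N) (toℕ j))

  record Triple : Set where
    field
      {i j l}   : ℕ
      i≤j       : i ≤ j
      j<l       : j < l
      l≤N       : l ≤ N
      same-ij   : g i ≡ g j
      same-jl   : g j ≡ g l
      same-from : h i j ≡ h i l

  triple : Triple
  triple with Fin.pigeonhole (n<1+n N) colour
  ... | j , k , j<k , eq
      with Fin.combine-injective (g (toℕ j)) _ (g (toℕ k)) _ eq
  ...   | gj≡gk , hj≡hk
        with first-least (g (toℕ j)) N (≤-pred (Fin.toℕ<n j)) refl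
  ...     | g≡ , ≤j = record
    { i≤j = ≤j ; j<l = j<k ; l≤N = ≤-pred (Fin.toℕ<n k)
    ; same-ij = g≡ ; same-jl = gj≡gk
    ; same-from = trans hj≡hk (cong (λ x → h (first x N) (toℕ k)) (≡-sym gj≡gk)) }

-- Cutting lists and paths

module _ {A : Set} where
  take-length-+ : ∀ (xs : List A) {ys} n → take (length xs + n) (xs ++ ys) ≡ xs ++ take n ys
  take-length-+ []       n = refl
  take-length-+ (x ∷ xs) n = cong (x ∷_) (take-length-+ xs n)

  drop-length-+ : ∀ (xs : List A) {ys} n → drop (length xs + n) (xs ++ ys) ≡ drop n ys
  drop-length-+ []       n = refl
  drop-length-+ (x ∷ xs) n = drop-length-+ xs n

  split-length : ∀ n {xs : List A} → n ≤ length xs → ∃₂ λ ys zs → xs ≡ ys ++ zs × length ys ≡ n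
  split-length zero    {xs}     _ = [] , xs , refl , refl
  split-length (suc n) {x ∷ xs} (s≤s le) with split-length n {xs} le
  ... | ys , zs , refl , refl = x ∷ ys , zs , refl , refl

  record Cut₄ (xs : List A) (i j k : ℕ) : Set where
    field
      as bs cs ds : List A
      whole  : xs ≡ as ++ bs ++ cs ++ ds
      cs≢[]  : 1 ≤ length cs
      takeᵢ  : take i xs ≡ as
      takeⱼ  : take j xs ≡ as ++ bs
      takeₖ  : take k xs ≡ as ++ bs ++ cs
      dropᵢ  : drop i xs ≡ bs ++ cs ++ ds
      dropⱼ  : drop j xs ≡ cs ++ ds
      dropₖ  : drop k xs ≡ ds
      takeᵢⱼ : take (j ∸ i) (drop i xs) ≡ bs
      takeᵢₖ : take (k ∸ i) (drop i xs) ≡ bs ++ cs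

  take-length : ∀ (xs : List A) {ys} → take (length xs) (xs ++ ys) ≡ xs
  take-length []       = refl
  take-length (x ∷ xs) = cong (x ∷_) (take-length xs)

  drop-length : ∀ (xs : List A) {ys} → drop (length xs) (xs ++ ys) ≡ ys
  drop-length []       = refl
  drop-length (x ∷ xs) = drop-length xs

  cut₄-lengths : ∀ as bs cs {ds} → 1 ≤ length cs →
    Cut₄ (as ++ bs ++ cs ++ ds) (length as) (length as + length bs) (length as + (length bs + length cs))
  cut₄-lengths as bs cs {ds} ne = record
    { whole = refl ; cs≢[] = ne
    ; takeᵢ = take-length as
    ; takeⱼ = trans (take-length-+ as _) (cong (as ++_) (take-length bs))
    ; takeₖ = trans (take-length-+ as _) (cong (as ++_) takeᵇᶜ)
    ; dropᵢ = drop-length as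
    ; dropⱼ = trans (drop-length-+ as _) (drop-length bs)
    ; dropₖ = trans (drop-length-+ as _) (trans (drop-length-+ bs _) (drop-length cs))
    ; takeᵢⱼ = trans (cong₂ take (m+n∸m≡n (length as) _) (drop-length as)) (take-length bs)
    ; takeᵢₖ = trans (cong₂ take (m+n∸m≡n (length as) _) (drop-length as)) takeᵇᶜ
    }
    where
    takeᵇᶜ : take (length bs + length cs) (bs ++ cs ++ ds) ≡ bs ++ cs
    takeᵇᶜ = trans (take-length-+ bs _) (cong (bs ++_) (take-length cs))

  cut₄ : ∀ {i j k} {xs : List A} → i ≤ j → j < k → k ≤ length xs → Cut₄ xs i j k
  cut₄ {i} {j} {k} {xs} i≤j j<k k≤ with split-length k {xs} k≤
  ... | abc , ds , refl , refl with split-length j {abc} (<⇒≤ j<k)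
  ...   | ab , cs , refl , refl with split-length i {ab} i≤j
  ...     | as , bs , refl , refl =
    subst₂ (λ j k → Cut₄ (((as ++ bs) ++ cs) ++ ds) (length as) j k) (≡-sym (length-++ as)) (≡-sym lengths)
      (subst (λ xs → Cut₄ xs _ _ _) (≡-sym assoc) (cut₄-lengths as bs cs nonempty))
    where
    assoc : ((as ++ bs) ++ cs) ++ ds ≡ as ++ bs ++ cs ++ ds
    assoc = trans (++-assoc (as ++ bs) cs ds) (++-assoc as bs (cs ++ ds))

    lengths : length ((as ++ bs) ++ cs) ≡ length as + (length bs + length cs)
    lengths = trans (length-++ (as ++ bs)) (trans (cong (_+ length cs) (length-++ as))
                (+-assoc (length as) _ _))

    nonempty : 1 ≤ length cs
    nonempty = +-cancelˡ-< (length (as ++ bs)) 0 (length cs)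
      (subst₂ _<_ (≡-sym (+-identityʳ _)) (length-++ (as ++ bs)) j<k)

infixr 5 _?∷_
_?∷_ : ∀ {A : Set} → Maybe A → List A → List A
nothing ?∷ ys = ys
just y  ?∷ ys = y ∷ ys

?∷-++ : ∀ {A : Set} m (xs ys : List A) → (m ?∷ xs) ++ ys ≡ m ?∷ (xs ++ ys)
?∷-++ nothing  xs ys = refl
?∷-++ (just _) xs ys = refl

module Paths {V Y : Set} (Edge : V → Maybe Y → V → Set) where

  infixr 5 _⊕_

  data Path : V → V → Set where
    []  : ∀ {x} → Path x x
    _∷_ : ∀ {x m y z} → Edge x m y → Path y z → Path x z

  word : ∀ {x y} → Path x y → List Y
  word []                = []
  word (_∷_ {m = m} _ π) = m ?∷ word π

  -- Edges are counted and not letters: a removed loop may be silent, and the descent in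
  -- `bounded-visits` needs a measure that decreases even then.
  len : ∀ {x y} → Path x y → ℕ
  len []      = 0
  len (_ ∷ π) = suc (len π)

  sources : ∀ {x y} → Path x y → List V
  sources []                = []
  sources (_∷_ {x = x} _ π) = x ∷ sources π

  _⊕_ : ∀ {x y z} → Path x y → Path y z → Path x z
  []      ⊕ ρ = ρ
  (e ∷ π) ⊕ ρ = e ∷ (π ⊕ ρ)

  ⊕-assoc : ∀ {w x y z} (π : Path w x) (ρ : Path x y) (σ : Path y z) → (π ⊕ ρ) ⊕ σ ≡ π ⊕ (ρ ⊕ σ)
  ⊕-assoc []      ρ σ = refl
  ⊕-assoc (e ∷ π) ρ σ = cong (e ∷_) (⊕-assoc π ρ σ)

  word-⊕ : ∀ {x y z} (π : Path x y) (ρ : Path y z) → word (π ⊕ ρ) ≡ word π ++ word ρ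
  word-⊕ []                ρ = refl
  word-⊕ (_∷_ {m = m} _ π) ρ = trans (cong (m ?∷_) (word-⊕ π ρ)) (≡-sym (?∷-++ m (word π) (word ρ)))

  len-⊕ : ∀ {x y z} (π : Path x y) (ρ : Path y z) → len (π ⊕ ρ) ≡ len π + len ρ
  len-⊕ []      ρ = refl
  len-⊕ (_ ∷ π) ρ = cong suc (len-⊕ π ρ)

  concatᴾ : ∀ {c} → List (Path c c) → Path c c
  concatᴾ []       = []
  concatᴾ (l ∷ ls) = l ⊕ concatᴾ ls

  concatᴾ-++ : ∀ {c} (ls ms : List (Path c c)) → concatᴾ (ls ++ ms) ≡ concatᴾ ls ⊕ concatᴾ ms
  concatᴾ-++ []       ms = refl
  concatᴾ-++ (l ∷ ls) ms = trans (cong (l ⊕_) (concatᴾ-++ ls ms)) (≡-sym (⊕-assoc l (concatᴾ ls) (concatᴾ ms)))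

  len-concatᴾ : ∀ {c} {ls : List (Path c c)} → All (λ l → 1 ≤ len l) ls → length ls ≤ len (concatᴾ ls)
  len-concatᴾ []                = z≤n
  len-concatᴾ {ls = l ∷ ls} (p ∷ ps) =
    ≤-trans (+-mono-≤ p (len-concatᴾ ps)) (≤-reflexive (≡-sym (len-⊕ l (concatᴾ ls))))

  module Visits (_≟_ : DecidableEquality V) where

    count : V → List V → ℕ
    count c [] = 0
    count c (x ∷ xs) with x ≟ c
    ... | yes _ = suc (count c xs)
    ... | no  _ = count c xs

    record Split {x t} (c : V) (π : Path x t) (n : ℕ) : Set where
      field
        before : Path x c
        loops  : List (Path c c)
        after  : Path c t
        proper : All (λ l → 1 ≤ len l) loops
        number : suc (length loops) ≡ n
        whole  : π ≡ before ⊕ (concatᴾ loops ⊕ after)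

    split : ∀ {x t} c (π : Path x t) {n} → suc n ≡ count c (sources π) → Split c π (suc n)
    split c (_∷_ {x = x} e π) eq with x ≟ c
    split c (_∷_ {x = x} e π) {zero} eq | yes refl = record
      { before = [] ; loops = [] ; after = e ∷ π ; proper = [] ; number = refl ; whole = refl }
    split c (_∷_ {x = x} e π) {suc n} eq | yes refl = record
      { before = [] ; loops = (e ∷ before) ∷ loops ; after = after ; proper = s≤s z≤n ∷ proper
      ; number = cong suc number
      ; whole  = cong (e ∷_) (trans whole (≡-sym (⊕-assoc before (concatᴾ loops) after))) }
      where open Split (split c π (suc-injective eq))
    split c (_∷_ {x = x} e π) eq | no _ = record
      { before = e ∷ before ; loops = loops ; after = after ; proper = proper ; number = number
      ; whole = cong (e ∷_) whole }
      where open Split (split c π eq)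

module Cut {Q B Y V : Set} (F : Finite Q) (q₀ : Q) (cell : Y → Behaviour.Cell {Q} {B})
           (_≟_ : DecidableEquality V) (Edge : V → Maybe Y → V → Set) where
  open Behaviour {Q} {B}
  open Pumping {Q} {B} q₀
  open Tables {Q} {B} F
  open Paths Edge
  open Visits _≟_

  tape : ∀ {x y} → Path x y → Tape
  tape π = map cell (word π)

  tape-⊕ : ∀ {x y z} (π : Path x y) (ρ : Path y z) → tape (π ⊕ ρ) ≡ tape π ++ tape ρ
  tape-⊕ π ρ = trans (cong (map cell) (word-⊕ π ρ)) (map-++ cell (word π) (word ρ))

  tape-⊕₃ : ∀ {w x y z} (π : Path w x) (ρ : Path x y) (σ : Path y z) →
            tape (π ⊕ (ρ ⊕ σ)) ≡ tape π ++ tape ρ ++ tape σ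
  tape-⊕₃ π ρ σ = trans (tape-⊕ π (ρ ⊕ σ)) (cong (tape π ++_) (tape-⊕ ρ σ))

  powᴾ : ∀ {c} → ℕ → Path c c → Path c c
  powᴾ zero    π = []
  powᴾ (suc n) π = π ⊕ powᴾ n π

  tape-pow : ∀ {c} n (π : Path c c) → tape (powᴾ n π) ≡ pow n (tape π)
  tape-pow zero    π = refl
  tape-pow (suc n) π = trans (tape-⊕ π (powᴾ n π)) (cong (tape π ++_) (tape-pow n π))

  pathClass : ∀ {x y} → Path x y → Fin classes
  pathClass π = class (tape π)

  -- The form in which finitarity reaches the pumping argument. It has to cover all paths with these
  -- ends, since pumped paths are among them.
  Bounded : V → V → ℕ → Set
  Bounded x t b = ∀ (π : Path x t) {z} → Acc (tape π) z → length z ≤ b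

  module _ {x t c b} (bound : Bounded x t b) (α : Path x c) (μ ν : Path c c) (ω : Path c t) where

    private
      class-⊑≡ : ∀ {x y x′ y′} → x ≡ x′ → y ≡ y′ → class x ≡ class y → x′ ⊑? y′
      class-⊑≡ refl refl = class-⊑

      bound-pow : ∀ (π : Path c c) {u} → tape π ≡ u →
                  ∀ n {z} → Acc (tape α ++ pow n u ++ tape ω) z → length z ≤ b
      bound-pow π refl n {z} r = bound (α ⊕ (powᴾ n π ⊕ ω)) (subst (λ t → Acc t z) (≡-sym eq) r)
        where
        eq : tape (α ⊕ (powᴾ n π ⊕ ω)) ≡ tape α ++ pow n (tape π) ++ tape ω
        eq = trans (tape-⊕₃ α (powᴾ n π) ω) (cong (λ x → tape α ++ x ++ tape ω) (tape-pow n π))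

    cut-path : pathClass α ≡ pathClass (α ⊕ μ) → pathClass α ≡ pathClass (α ⊕ (μ ⊕ ν)) →
               pathClass ω ≡ pathClass (ν ⊕ ω) → pathClass ω ≡ pathClass (μ ⊕ (ν ⊕ ω)) →
               pathClass μ ≡ pathClass (μ ⊕ ν) →
               ∀ {z} → Acc (tape (α ⊕ (μ ⊕ (ν ⊕ ω)))) z → Acc (tape (α ⊕ (μ ⊕ ω))) z
    cut-path c₁ c₂ c₃ c₄ c₅ {z} r =
      subst (λ t → Acc t z) (≡-sym (tape-⊕₃ α μ ω))
        (cut-tape {b = b} {tape α} {tape μ} {tape ν} {tape ω}
          (class-⊑≡ refl (tape-⊕ α μ) c₁) (class-⊑≡ refl (tape-⊕₃ α μ ν) c₂)
          (class-⊑≡ refl (tape-⊕₃ μ ν ω) c₄) (class-⊑≡ (tape-⊕₃ μ ν ω) refl (≡-sym c₄))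
          (class-⊑≡ refl (tape-⊕ ν ω) c₃) (class-⊑≡ (tape-⊕ ν ω) refl (≡-sym c₃))
          (class-⊑≡ (tape-⊕ μ ν) refl (≡-sym c₅))
          (bound-pow μ refl) (bound-pow (μ ⊕ ν) (tape-⊕ μ ν))
          (subst (λ t → Acc t z) (trans (tape-⊕ α (μ ⊕ (ν ⊕ ω))) (cong (tape α ++_) (tape-⊕₃ μ ν ω))) r))

  -- One class for the prefix and one for the suffix, then one for the segment from the first such boundary.
  maxLoops : ℕ
  maxLoops = (classes * classes) * classes

  Shorter : ∀ {x t} → Path x t → List B → Set
  Shorter {x} {t} π z = ∃ λ (π′ : Path x t) → Acc (tape π′) z × len π′ < len π

  module _ {x t c b} (bound : Bounded x t b) (α : Path x c) (ω : Path c t) where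

    module _ (ls : List (Path c c)) (proper : All (λ l → 1 ≤ len l) ls) (many : maxLoops ≤ length ls) where

      prefix suffix : ℕ → Fin classes
      prefix i = pathClass (α ⊕ concatᴾ (take i ls))
      suffix i = pathClass (concatᴾ (drop i ls) ⊕ ω)

      segment : ℕ → ℕ → Fin classes
      segment i j = pathClass (concatᴾ (take (j ∸ i) (drop i ls)))

      open Pigeonhole (λ i → combine (prefix i) (suffix i)) segment using (N; Triple; triple)

      module _ (τ : Triple) (κ : Cut₄ ls (Triple.i τ) (Triple.j τ) (Triple.l τ)) where
        open Triple τ
        open Cut₄ κ

        -- The loops `bs` play the role of u and the loops `cs` that of v. Since only `cs` is
        -- removed, only `cs` must be nonempty; `bs` is empty if `i` and `j` coincide.
        shorten-at : ∀ {z} → Acc (tape (α ⊕ (concatᴾ ls ⊕ ω))) z → Shorter (α ⊕ (concatᴾ ls ⊕ ω)) z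
        shorten-at {z} r = α′ ⊕ (μ ⊕ ω′)
          , cut-path bound α′ μ ν ω′
              (trans (≡-sym prefixᵢ) (trans (proj₁ same₁) prefixⱼ))
              (trans (≡-sym prefixᵢ) (trans (trans (proj₁ same₁) (proj₁ same₂)) prefixₖ))
              (trans (≡-sym suffixₖ) (trans (≡-sym (proj₂ same₂)) suffixⱼ))
              (trans (≡-sym suffixₖ) (trans (≡-sym (trans (proj₂ same₁) (proj₂ same₂))) suffixᵢ))
              (trans (cong (pathClass ∘ concatᴾ) (≡-sym takeᵢⱼ))
                (trans same-from (cong pathClass (trans (cong concatᴾ takeᵢₖ) (concatᴾ-++ bs cs)))))
              (subst (λ π → Acc (tape π) z) path r)
          , shorter
          where
          α′ = α ⊕ concatᴾ as
          μ  = concatᴾ bs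
          ν  = concatᴾ cs
          ω′ = concatᴾ ds ⊕ ω

          same₁ = Fin.combine-injective (prefix i) (suffix i) (prefix j) (suffix j) same-ij
          same₂ = Fin.combine-injective (prefix j) (suffix j) (prefix l) (suffix l) same-jl

          after-cs : concatᴾ (cs ++ ds) ⊕ ω ≡ ν ⊕ ω′
          after-cs = trans (cong (_⊕ ω) (concatᴾ-++ cs ds)) (⊕-assoc ν (concatᴾ ds) ω)

          after-bs : concatᴾ (bs ++ cs ++ ds) ⊕ ω ≡ μ ⊕ (ν ⊕ ω′)
          after-bs = trans (cong (_⊕ ω) (concatᴾ-++ bs (cs ++ ds)))
                       (trans (⊕-assoc μ (concatᴾ (cs ++ ds)) ω) (cong (μ ⊕_) after-cs))

          before : ∀ ls → α ⊕ concatᴾ (as ++ ls) ≡ α′ ⊕ concatᴾ ls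
          before ls = trans (cong (α ⊕_) (concatᴾ-++ as ls)) (≡-sym (⊕-assoc α (concatᴾ as) (concatᴾ ls)))

          prefixᵢ : prefix i ≡ pathClass α′
          prefixᵢ = cong (λ l → pathClass (α ⊕ concatᴾ l)) takeᵢ
          prefixⱼ : prefix j ≡ pathClass (α′ ⊕ μ)
          prefixⱼ = cong pathClass (trans (cong (λ l → α ⊕ concatᴾ l) takeⱼ) (before bs))
          prefixₖ : prefix l ≡ pathClass (α′ ⊕ (μ ⊕ ν))
          prefixₖ = cong pathClass (trans (cong (λ l → α ⊕ concatᴾ l) takeₖ)
                      (trans (before (bs ++ cs)) (cong (α′ ⊕_) (concatᴾ-++ bs cs))))
          suffixᵢ : suffix i ≡ pathClass (μ ⊕ (ν ⊕ ω′))
          suffixᵢ = cong pathClass (trans (cong (λ l → concatᴾ l ⊕ ω) dropᵢ) after-bs)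
          suffixⱼ : suffix j ≡ pathClass (ν ⊕ ω′)
          suffixⱼ = cong pathClass (trans (cong (λ l → concatᴾ l ⊕ ω) dropⱼ) after-cs)
          suffixₖ : suffix l ≡ pathClass ω′
          suffixₖ = cong (λ l → pathClass (concatᴾ l ⊕ ω)) dropₖ

          path : α ⊕ (concatᴾ ls ⊕ ω) ≡ α′ ⊕ (μ ⊕ (ν ⊕ ω′))
          path = trans (cong (λ l → α ⊕ (concatᴾ l ⊕ ω)) whole)
            (trans (cong (λ π → α ⊕ (π ⊕ ω)) (concatᴾ-++ as (bs ++ cs ++ ds)))
            (trans (cong (α ⊕_) (⊕-assoc (concatᴾ as) (concatᴾ (bs ++ cs ++ ds)) ω))
            (trans (≡-sym (⊕-assoc α (concatᴾ as) _)) (cong (α′ ⊕_) after-bs))))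

          proper-cs : ∀ as bs → All (λ l → 1 ≤ len l) (as ++ bs ++ cs ++ ds) → All (λ l → 1 ≤ len l) cs
          proper-cs as bs p = ++⁻ˡ cs (++⁻ʳ bs (++⁻ʳ as p))

          ν-proper : 1 ≤ len ν
          ν-proper = ≤-trans cs≢[] (len-concatᴾ (proper-cs as bs (subst (All _) whole proper)))

          shorter : len (α′ ⊕ (μ ⊕ ω′)) < len (α ⊕ (concatᴾ ls ⊕ ω))
          shorter = subst₂ _<_
            (≡-sym (trans (len-⊕ α′ (μ ⊕ ω′)) (cong (len α′ +_) (len-⊕ μ ω′))))
            (≡-sym (trans (cong len path) (trans (len-⊕ α′ (μ ⊕ (ν ⊕ ω′)))
              (cong (len α′ +_) (trans (len-⊕ μ (ν ⊕ ω′)) (cong (len μ +_) (len-⊕ ν ω′)))))))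
            (+-monoʳ-< (len α′) (+-monoʳ-< (len μ) (+-monoˡ-≤ (len ω′) ν-proper)))

      shorten : ∀ {z} → Acc (tape (α ⊕ (concatᴾ ls ⊕ ω))) z → Shorter (α ⊕ (concatᴾ ls ⊕ ω)) z
      -- Here `N` unfolds to `maxLoops`: that many loops have `suc N` boundaries, which is what the
      -- pigeonhole needs.
      shorten = shorten-at triple (cut₄ i≤j j<l (≤-trans l≤N many))
        where open Triple triple

  -- The condition ranges only over vertices on the path, which keeps it decidable although `V` need
  -- not be finite.
  FewVisits : ∀ {x t} → Path x t → Set
  FewVisits π = All (λ c → count c (sources π) ≤ suc maxLoops) (sources π)

  bounded-visits : ∀ {x t b} → Bounded x t b → ∀ (π : Path x t) {z} → Acc (tape π) z →
                   ∃ λ (π′ : Path x t) → Acc (tape π′) z × FewVisits π′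
  bounded-visits {x} {t} bound π r = descend π r (<-wellFounded (len π))
    where
    descend : ∀ π {z} → Acc (tape π) z → WF.Acc _<_ (len π) → ∃ λ (π′ : Path x t) → Acc (tape π′) z × FewVisits π′
    descend π {z} r (WF.acc rec) with all? (λ c → count c (sources π) ≤? suc maxLoops) (sources π)
    ... | yes few = π , r , few
    ... | no ¬few with satisfied (¬All⇒Any¬ (λ c → count c (sources π) ≤? suc maxLoops) (sources π) ¬few)
    ...   | c , many with count c (sources π) in eq
    ...     | zero  = ⊥-elim (many z≤n)
    ...     | suc n =
      let (π′ , r′ , lt) = shorten bound before after loops proper
            -- There is one loop fewer than there are visits, so this many visits leave one loop
            -- more than `shorten` asks for.
            (≤-trans (n≤1+n _) (≤-pred (subst (suc maxLoops <_) (≡-sym number) (≰⇒> many))))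
            (subst (λ π → Acc (tape π) z) whole r)
      in descend π′ r′ (rec (subst (λ π → len π′ < len π) (≡-sym whole) lt))
      where open Split (split c π (≡-sym eq))

-- Deterministic simulation on a labelled tape

at : ∀ {A : Set} → List A → ℕ → Maybe A
at []       _       = nothing
at (x ∷ xs) zero    = just x
at (x ∷ xs) (suc i) = at xs i

at-map : ∀ {A B : Set} (f : A → B) xs {i x} → at xs i ≡ just x → at (map f xs) i ≡ just (f x)
at-map f (x ∷ xs) {zero}  refl = refl
at-map f (x ∷ xs) {suc i} eq   = at-map f xs eq

at-ʳ++ : ∀ {A : Set} (xs {ys} : List A) n → at (xs ʳ++ ys) (length xs + n) ≡ at ys n
at-ʳ++ []            n = refl
at-ʳ++ (x ∷ xs) {ys} n = trans (cong (at (xs ʳ++ x ∷ ys)) (≡-sym (+-suc (length xs) n))) (at-ʳ++ xs (suc n))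

at-focus : ∀ {A : Set} (xs {ys} : List A) → at (xs ʳ++ ys) (length xs) ≡ at ys 0
at-focus xs = trans (cong (at (xs ʳ++ _)) (≡-sym (+-identityʳ (length xs)))) (at-ʳ++ xs 0)

opposite : Move → Move
opposite left  = right
opposite stay  = stay
opposite right = left

move-opposite : ∀ m {i j} → move m i ≡ just j → move (opposite m) j ≡ just i
move-opposite left {suc i} refl = refl
move-opposite stay  refl = refl
move-opposite right refl = refl

record DM (Γ : Set) (b : ℕ) : Set₁ where
  field
    Q      : Set
    finite : Finite Q
    start  : Q
    step   : Γ → Q → Act Q (Fin b)

  open Behaviour {Q} {Fin b} public

  Accepts : List Γ → List (Fin b) → Set
  Accepts v z = Run rgt [] start (map step v) z accepted

  -- Accepting runs by head position. `Run` is the form that decomposes along concatenations, `At`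
  -- the form that compares with generators and 2gsm's.
  data At (v : List Γ) : Q → ℕ → List (Fin b) → Set where
    halt : ∀ {γ q i} → at v i ≡ just γ → step γ q ≡ accept → At v q i []
    act  : ∀ {γ q q′ i j α m z} → at v i ≡ just γ → step γ q ≡ go q′ α m → move m i ≡ just j →
           At v q′ j z → At v q i (α ++ z)

  Run⇒At : ∀ {v ls q rs z} → ls ʳ++ rs ≡ v → Run rgt (map step ls) q (map step rs) z accepted → At v q (length ls) z
  Run⇒Atᴸ : ∀ {v l ls q rs z} → ls ʳ++ l ∷ rs ≡ v → Run lft (step l ∷ map step ls) q (map step rs) z accepted →
            At v q (length ls) z
  Run⇒At {ls = ls} {rs = r ∷ rs} refl (acc p)    = halt (at-focus ls) p
  Run⇒At {ls = ls} {rs = r ∷ rs} refl (goˢ p s)  = act (at-focus ls) p refl (Run⇒At {ls = ls} {rs = r ∷ rs} refl s)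
  Run⇒At {ls = ls} {rs = r ∷ rs} refl (goᴿ p s) = act (at-focus ls) p refl (Run⇒At {ls = r ∷ ls} {rs = rs} refl s)
  Run⇒At {ls = l ∷ ls} {rs = r ∷ rs} refl (goᴸ p s) =
    act (at-focus (l ∷ ls)) p refl (Run⇒Atᴸ {l = l} {ls} {rs = r ∷ rs} refl s)
  Run⇒Atᴸ {l = l} {ls} {rs = rs} eq (turn s) = Run⇒At {ls = ls} {rs = l ∷ rs} eq s

  At⇒Run : ∀ {v q i z} ls rs → ls ʳ++ rs ≡ v → length ls ≡ i → At v q i z →
           Run rgt (map step ls) q (map step rs) z accepted
  At⇒Run ls [] refl refl (halt eq p) with () ← trans (≡-sym eq) (at-focus ls)
  At⇒Run ls [] refl refl (act eq p _ _) with () ← trans (≡-sym eq) (at-focus ls)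
  At⇒Run ls (r ∷ rs) refl refl (halt eq p) with refl ← trans (≡-sym eq) (at-focus ls) = acc p
  At⇒Run ls (r ∷ rs) refl refl (act {m = stay} eq p refl s) with refl ← trans (≡-sym eq) (at-focus ls) =
    goˢ p (At⇒Run ls (r ∷ rs) refl refl s)
  At⇒Run ls (r ∷ rs) refl refl (act {m = right} eq p refl s) with refl ← trans (≡-sym eq) (at-focus ls) =
    goᴿ p (At⇒Run (r ∷ ls) rs refl refl s)
  At⇒Run (l ∷ ls) (r ∷ rs) refl refl (act {m = left} eq p refl s) with refl ← trans (≡-sym eq) (at-focus (l ∷ ls)) =
    goᴸ p (turn (At⇒Run ls (l ∷ r ∷ rs) refl refl s))

  Accepts⇒At : ∀ {v z} → Accepts v z → At v start 0 z
  Accepts⇒At {v} = Run⇒At {ls = []} {rs = v} refl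

  At⇒Accepts : ∀ {v z} → At v start 0 z → Accepts v z
  At⇒Accepts {v} = At⇒Run [] v refl refl

-- A nondeterministic two-way machine that emits at most one letter per transition. As `start` is
-- never entered, a walk backwards recognises the beginning of the run; as `end` is never left, a
-- walk forwards recognises its end.
record Gen (A Y : Set) : Set₁ where
  field
    S         : Set
    finite    : Finite S
    δ         : S → A → List (Maybe Y × Move × S)
    start end : S
    no-entry  : ∀ {s a y m s′} → (y , m , s′) ∈ δ s a → s′ ≢ start
    no-exit   : ∀ {s a y m s′} → (y , m , s′) ∈ δ s a → s ≢ end

  V : Set
  V = ℕ × S

  _≟ⱽ_ : DecidableEquality V
  _≟ⱽ_ = ≡-dec ℕ._≟_ (_≟_ finite)

  -- Only the source has to lie on the tape. For inner vertices of a path the next edge gives the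
  -- same, so the last position is the only one that needs a separate hypothesis.
  Edge : List A → V → Maybe Y → V → Set
  Edge t (i , s) y (j , s′) = ∃₂ λ a m → at t i ≡ just a × (y , m , s′) ∈ δ s a × move m i ≡ just j

module Simulation {A Y : Set} {b : ℕ} (finA : Finite A) (finY : Finite Y)
                  (G : Gen A Y) (D : DM Y b) (C : ℕ) where
  open Gen G using (S; δ; start; end; no-entry; no-exit; V; Edge)
  open DM D using (Q; step; Run; acc; goˢ; goᴿ; goᴸ; turn)

  -- The index numbers the visits to a configuration, so that no indexed configuration is visited twice.
  S′ : Set
  S′ = S × Fin (suc C)

  S′-finite : Finite S′
  S′-finite = ×-finite (Gen.finite G) (Fin-finite (suc C))

  Forward Backward : Set
  Forward  = Maybe Y × Move × S′
  Backward = Move × S′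

  Label : Set
  Label = A × Vec (Maybe Forward) (size S′-finite) × Vec (Maybe Backward) (size S′-finite)

  Backward-finite : Finite Backward
  Backward-finite = ×-finite Move-finite S′-finite

  Label-finite : Finite Label
  Label-finite = ×-finite finA (×-finite
    (Vec-finite _ (Maybe-finite (×-finite (Maybe-finite finY) (×-finite Move-finite S′-finite))))
    (Vec-finite _ (Maybe-finite Backward-finite)))

  letter : Label → A
  letter = proj₁

  forward : Label → S′ → Maybe Forward
  forward (_ , f , _) s = lookup f (enc S′-finite s)

  backward : Label → S′ → Maybe Backward
  backward (_ , _ , g) s = lookup g (enc S′-finite s)

  open DecMembership (_≟_ (×-finite (Maybe-finite finY) (×-finite Move-finite (Gen.finite G)))) using (_∈?_)

  -- Illegal guesses are discarded when they are read, so whatever the machine follows forwards is a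
  -- path of the generator.
  validate : A → S → Maybe Forward → Maybe Forward
  validate a s nothing = nothing
  validate a s (just (y , m , s′)) with (y , m , proj₁ s′) ∈? δ s a
  ... | yes _ = just (y , m , s′)
  ... | no  _ = nothing

  next : Label → S′ → Maybe Forward
  next ℓ s = validate (letter ℓ) (proj₁ s) (forward ℓ s)

  validate-sound : ∀ a s f {y m s′} → validate a s f ≡ just (y , m , s′) → (y , m , proj₁ s′) ∈ δ s a
  validate-sound a s (just (y , m , s′)) eq with (y , m , proj₁ s′) ∈? δ s a
  validate-sound a s (just (y , m , s′)) refl | yes p = p

  validate-complete : ∀ {a s y m s′} → (y , m , proj₁ s′) ∈ δ s a → validate a s (just (y , m , s′)) ≡ just (y , m , s′)
  validate-complete {a} {s} {y} {m} {s′} p with (y , m , proj₁ s′) ∈? δ s a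
  ... | yes _ = refl
  ... | no ¬p = ⊥-elim (¬p p)

  -- With the generator in state s on the current cell: fw q and bk q are the state q of D about to read
  -- the next, respectively the previous, output letter; chk verifies the backward pointer after a forward
  -- move, back completes a backward move, and drain runs the generator to its end once D has accepted.
  data Mode : Set where
    fw bk back : Q → Mode
    chk        : Q → Move → S′ → Mode
    drain      : Mode

  Mode-finite : Finite Mode
  Mode-finite = retract-finite to from from-to
    (⊎-finite (×-finite (Fin-finite 3) FQ) (Maybe-finite (×-finite FQ Backward-finite)))
    where
    FQ = DM.finite D

    to : Mode → (Fin 3 × Q) ⊎ Maybe (Q × Backward)
    to (fw q)      = inj₁ (zero , q)
    to (bk q)      = inj₁ (suc zero , q)
    to (back q)    = inj₁ (suc (suc zero) , q)
    to (chk q m s) = inj₂ (just (q , m , s))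
    to drain       = inj₂ nothing

    from : (Fin 3 × Q) ⊎ Maybe (Q × Backward) → Mode
    from (inj₁ (zero , q))           = fw q
    from (inj₁ (suc zero , q))       = bk q
    from (inj₁ (suc (suc zero) , q)) = back q
    from (inj₂ (just (q , m , s)))   = chk q m s
    from (inj₂ nothing)              = drain

    from-to : ∀ m → from (to m) ≡ m
    from-to (fw q)      = refl
    from-to (bk q)      = refl
    from-to (back q)    = refl
    from-to (chk q m s) = refl
    from-to drain       = refl

  State : Set
  State = Mode × S′

  Action : Set
  Action = Act State (Fin b)

  onRead : S′ → Move → S′ → Act Q (Fin b) → Action
  onRead s m s′ stop           = stop
  -- Accepting here would be unsound: the labels ahead have not been followed, and the letters read
  -- so far might not extend to a complete run.
  onRead s m s′ accept         = go (drain , s) [] stay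
  onRead s m s′ (go q α stay)  = go (fw q , s) α stay
  onRead s m s′ (go q α right) = go (chk q m s , s′) α m
  onRead s m s′ (go q α left)  = go (bk q , s) α stay

  onForward : Q → S′ → Maybe Forward → Action
  onForward q s nothing                  = stop
  onForward q s (just (nothing , m , s′)) = go (chk q m s , s′) [] m
  onForward q s (just (just y , m , s′))  = onRead s m s′ (step y q)

  onBackward : Q → Maybe Backward → Action
  onBackward q nothing        = stop
  onBackward q (just (m , s)) = go (back q , s) [] m

  onBack : Q → S′ → Maybe Forward → Action
  onBack q s nothing                = stop
  onBack q s (just (nothing , _))   = go (bk q , s) [] stay
  onBack q s (just (just _ , _))    = go (fw q , s) [] stay

  onDrain : Maybe Forward → Action
  onDrain nothing              = stop
  onDrain (just (_ , m , s)) = go (drain , s) [] m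

  step′ : Label → State → Action
  step′ ℓ (fw q , s) = onForward q s (next ℓ s)
  step′ ℓ (bk q , s) with _≟_ (Gen.finite G) (proj₁ s) start
  -- Nothing is written before `start`, so D leaves its tape on the left. A backward pointer guessed
  -- here would also be unconfirmed.
  ... | yes _ = stop
  ... | no  _ = onBackward q (backward ℓ s)
  step′ ℓ (back q , s) = onBack q s (next ℓ s)
  step′ ℓ (chk q m s₀ , s) with _≟_ (Maybe-finite Backward-finite) (backward ℓ s) (just (opposite m , s₀))
  ... | yes _ = go (fw q , s) [] stay
  ... | no  _ = stop
  step′ ℓ (drain , s) with _≟_ (Gen.finite G) (proj₁ s) end
  ... | yes _ = accept
  ... | no  _ = onDrain (next ℓ s)

  machine : DM Label b
  machine = record
    { Q = State ; finite = ×-finite Mode-finite S′-finite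
    ; start = fw (DM.start D) , (start , zero) ; step = step′ }

  open DM machine using (At; halt; act)

  Node : Set
  Node = ℕ × S′

  Next : List Label → Node → Maybe Y → Node → Set
  Next v (i , s) y (j , s′) = ∃₂ λ ℓ m → at v i ≡ just ℓ × next ℓ s ≡ just (y , m , s′) × move m i ≡ just j

  Prev : List Label → Node → Node → Set
  Prev v (i , s) (j , s′) = ∃₂ λ ℓ m → at v i ≡ just ℓ × backward ℓ s ≡ just (m , s′) × move m i ≡ just j

  Next-unique : ∀ {v x y x₁ y′ x₂} → Next v x y x₁ → Next v x y′ x₂ → y ≡ y′ × x₁ ≡ x₂
  Next-unique (_ , _ , p , q , r) (_ , _ , p′ , q′ , r′)
    with refl ← trans (≡-sym p) p′ with refl ← trans (≡-sym q) q′ with refl ← trans (≡-sym r) r′ = refl , refl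

  Next-at : ∀ {v i s y j s′ ℓ} → at v i ≡ just ℓ → (e : Next v (i , s) y (j , s′)) →
            next ℓ s ≡ just (y , proj₁ (proj₂ e) , s′)
  Next-at p (_ , _ , p′ , q , _) with refl ← trans (≡-sym p) p′ = q

  -- Soundness: an accepted labelling encodes a run

  module Sound (v : List Label) where

    -- Every edge of the past comes with its confirmed backward pointer, so the way back retraces
    -- it. The letters are collected in reverse, as `Run` stores its left tape.
    data Past : Node → List Y → Set where
      origin : Past (0 , (start , zero)) []
      snoc   : ∀ {x₀ y x ls} → Past x₀ ls → Next v x₀ y x → Prev v x x₀ → Past x (y ?∷ ls)

    data Future : Node → List Y → Set where
      final : ∀ {i s} → proj₁ s ≡ end → Future (i , s) []
      cons  : ∀ {x y x₁ rs} → Next v x y x₁ → Future x₁ rs → Future x (y ?∷ rs)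

    uncons : ∀ {x y x₁ rs} → Next v x y x₁ → Future x rs → ∃ λ rs′ → rs ≡ y ?∷ rs′ × Future x₁ rs′
    uncons (ℓ , m , p , q , r) (final refl) =
      ⊥-elim (no-exit (validate-sound (letter ℓ) _ (forward ℓ _) q) refl)
    uncons e (cons e′ f) with refl , refl ← Next-unique {v} e e′ = _ , refl , f

    future-head : ∀ {i s ℓ y m s′ rs} → at v i ≡ just ℓ → next ℓ s ≡ just (y , m , s′) →
                  Future (i , s) rs → ∃ λ rs′ → rs ≡ y ?∷ rs′
    future-head {ℓ = ℓ} p q (final refl) = ⊥-elim (no-exit (validate-sound (letter ℓ) _ (forward ℓ _) q) refl)
    future-head p q (cons (_ , _ , p′ , q′ , _) f)
      with refl ← trans (≡-sym p) p′ with refl ← trans (≡-sym q) q′ = _ , refl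

    cells : List Y → DM.Tape D
    cells = map step

    -- The past is an input and the future an output: that the run can be completed is known only
    -- once `drain` has reached `end`, and is carried back by induction on the rest of the
    -- computation. Since `Next` is functional, the future found there fits every earlier node.
    Simulated : Mode → Node → List (Fin b) → Set
    Simulated (fw q) x z = ∀ {ls} → Past x ls → ∃ λ rs → Future x rs × Run rgt (cells ls) q (cells rs) z accepted
    Simulated (bk q) x z = ∀ {ls} → Past x ls → ∃ λ rs → Future x rs × Run lft (cells ls) q (cells rs) z accepted
    Simulated (back q) x z = ∀ {ls y x₁} → Past x ls → Next v x y x₁ →
      ∃ λ rs → Future x₁ rs × Run lft (cells (y ?∷ ls)) q (cells rs) z accepted
    Simulated (chk q m s₀) (i , s) z = ∀ {ls y i₀} → Past (i₀ , s₀) ls → Next v (i₀ , s₀) y (i , s) →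
      move m i₀ ≡ just i → ∃ λ rs → Future (i , s) rs × Run rgt (cells (y ?∷ ls)) q (cells rs) z accepted
    Simulated drain x z = z ≡ [] × ∃ (Future x)

    simulated : ∀ {mode s i z} → At v (mode , s) i z → Simulated mode (i , s) z
    simulated {fw q} {s} (halt {γ = ℓ} p eq) with next ℓ s
    ... | just (just y , _) with step y q
    simulated {fw q} {s} (halt {γ = ℓ} p ()) | just (just y , _) | go _ _ stay
    simulated {fw q} {s} (halt {γ = ℓ} p ()) | just (just y , _) | go _ _ left
    simulated {fw q} {s} (halt {γ = ℓ} p ()) | just (just y , _) | go _ _ right
    simulated {fw q} {s} (act {γ = ℓ} p eq mv r) past with next ℓ s in nx
    simulated {fw q} {s} (act p refl mv r) past | just (nothing , m , s₁) =
      let (rs , f , run) = simulated r past (_ , _ , p , nx , mv) mv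
      in rs , cons (_ , _ , p , nx , mv) f , run
    ... | just (just y , m , s₁) with step y q in st
    simulated {fw q} {s} (act p refl refl r) past | just (just y , m , s₁) | accept
        with refl , rs , f ← simulated r
        with rs′ , refl ← future-head p nx f = _ , f , acc st
    simulated {fw q} {s} (act p refl refl r) past | just (just y , m , s₁) | go q′ α stay
        with rs , f , run ← simulated r past
        with rs′ , refl ← future-head p nx f = _ , f , goˢ st run
    simulated {fw q} {s} (act p refl refl r) past | just (just y , m , s₁) | go q′ α left
        with rs , f , run ← simulated r past
        with rs′ , refl ← future-head p nx f = _ , f , goᴸ st run
    simulated {fw q} {s} (act p refl mv r) past | just (just y , m , s₁) | go q′ α right =
      let (rs , f , run) = simulated r past (_ , _ , p , nx , mv) mv
      in y ∷ rs , cons (_ , _ , p , nx , mv) f , goᴿ st run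
    simulated {bk q} {s} (halt {γ = ℓ} p eq) past with _≟_ (Gen.finite G) (proj₁ s) start
    simulated {bk q} {s} (halt {γ = ℓ} p eq) past | no _ with backward ℓ s
    simulated {bk q} {s} (halt {γ = ℓ} p ()) past | no _ | just _
    simulated {bk q} {s} (act {γ = ℓ} p eq mv r) past with _≟_ (Gen.finite G) (proj₁ s) start
    ... | no s≢start with past
    ...   | origin = ⊥-elim (s≢start refl)
    -- The pointer that the machine reads is the one stored with the last edge of the past, so the
    -- machine arrives at the source of that edge.
    ...   | snoc past₀ e (_ , _ , p′ , bw , mv′)
            with refl ← trans (≡-sym p) p′ with backward ℓ s
    simulated {bk q} {s} (act {γ = ℓ} p refl mv r) past | no s≢start | snoc past₀ e (_ , _ , p′ , refl , mv′) | just _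
            with refl ← trans (≡-sym mv) mv′ = simulated r past₀ e
    simulated {back q} {s} (halt {γ = ℓ} p eq) past e with next ℓ s
    simulated {back q} {s} (halt {γ = ℓ} p ()) past e | just (nothing , _)
    simulated {back q} {s} (halt {γ = ℓ} p ()) past e | just (just _ , _)
    simulated {back q} {s} (act {γ = ℓ} p eq mv r) {y = nothing} past e
      with refl ← trans (≡-sym (cong (onBack q s) (Next-at {v} p e))) eq with refl ← mv
      with rs , f , run ← simulated r past
      with rs′ , refl , f′ ← uncons e f = rs′ , f′ , run
    simulated {back q} {s} (act {γ = ℓ} p eq mv r) {y = just _} past e
      with refl ← trans (≡-sym (cong (onBack q s) (Next-at {v} p e))) eq with refl ← mv
      with rs , f , run ← simulated r past
      with rs′ , refl , f′ ← uncons e f = rs′ , f′ , turn run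
    simulated {chk q m s₀} {s} (halt {γ = ℓ} p eq) past e mv
      with _≟_ (Maybe-finite Backward-finite) (backward ℓ s) (just (opposite m , s₀))
    simulated {chk q m s₀} {s} (halt {γ = ℓ} p ()) past e mv | yes _
    simulated {chk q m s₀} {s} (halt {γ = ℓ} p ()) past e mv | no _
    simulated {chk q m s₀} {s} (act {γ = ℓ} p eq mv′ r) past e mv
      with _≟_ (Maybe-finite Backward-finite) (backward ℓ s) (just (opposite m , s₀))
    simulated {chk q m s₀} {s} (act {γ = ℓ} p refl refl r) past e mv | yes bw =
      simulated r (snoc past e (ℓ , opposite m , p , bw , move-opposite m mv))
    simulated {drain} {s} (halt {γ = ℓ} p eq) with _≟_ (Gen.finite G) (proj₁ s) end
    ... | yes s≡end = refl , [] , final s≡end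
    ... | no _ with next ℓ s
    simulated {drain} {s} (halt {γ = ℓ} p ()) | no _ | just _
    simulated {drain} {s} (act {γ = ℓ} p eq mv r) with _≟_ (Gen.finite G) (proj₁ s) end
    ... | no _ with next ℓ s in nx
    simulated {drain} {s} (act {γ = ℓ} p refl mv r) | no _ | just (y , m , s₁) =
      let (eq , rs , f) = simulated r in eq , y ?∷ rs , cons (_ , _ , p , nx , mv) f

    open Paths (Edge (map letter v))

    Future⇒Path : ∀ {i s rs} → Future (i , s) rs →
                  ∃₂ λ j (π : Path (i , proj₁ s) (j , end)) → word π ≡ rs
    Future⇒Path (final refl) = _ , [] , refl
    Future⇒Path {s = s} (cons {y = y} (ℓ , m , p , q , mv) f) =
      let (j , π , eq) = Future⇒Path f
      in j , (letter ℓ , m , at-map letter v p , validate-sound (letter ℓ) (proj₁ s) (forward ℓ s) q , mv) ∷ π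
           , cong (y ?∷_) eq

    machine-sound : ∀ {z} → DM.Accepts machine v z →
                    ∃₂ λ j (π : Path (0 , start) (j , end)) → DM.Accepts D (word π) z
    machine-sound {z} r =
      let (rs , f , run) = simulated (DM.Accepts⇒At machine r) origin
          (j , π , eq) = Future⇒Path f
      in j , π , subst (λ w → DM.Accepts D w z) (≡-sym eq) run

  -- Completeness: labelling a run with few visits

  module Complete (t : List A) where
    open Paths (Edge t)
    open Visits (Gen._≟ⱽ_ G)

    -- Along a path satisfying `Few` all numbers passed here are at most `C`, so the default `zero`
    -- never identifies two visits.
    clamp : ℕ → Fin (suc C)
    clamp n with n <? suc C
    ... | yes lt = fromℕ< lt
    ... | no  _  = zero

    clamp-injective : ∀ {m n} → m ≤ C → n ≤ C → clamp m ≡ clamp n → m ≡ n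
    clamp-injective {m} {n} m≤ n≤ eq with m <? suc C | n <? suc C
    ... | yes p | yes q = Fin.fromℕ<-injective m n p q eq
    ... | no ¬p | _     = ⊥-elim (¬p (s≤s m≤))
    ... | _     | no ¬q = ⊥-elim (¬q (s≤s n≤))

    node : V → Fin (suc C) → Node
    node (i , s) k = i , (s , k)

    -- The k-th last visit to x has index k ∸ 1.
    index : ∀ {x y} → Path x y → Fin (suc C)
    index []          = zero
    index {x} (_ ∷ π) = clamp (count x (sources π))

    origin-of : ∀ {x y} → Path x y → Node
    origin-of {x} π = node x (index π)

    record Entry : Set where
      constructor entry
      field
        source : Node
        output : Maybe Y
        moved  : Move
        target : Node

    open Entry

    trace : ∀ {x y} → Path x y → List Entry
    trace []                                      = []
    trace (_∷_ {m = y} e@(_ , m , _) π) = entry (origin-of (e ∷ π)) y m (origin-of π) ∷ trace π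

    Few : ∀ {x y} → Path x y → Set
    Few π = ∀ c → count c (sources π) ≤ suc C

    count-∷ : ∀ c x xs → count c xs ≤ count c (x ∷ xs)
    count-∷ c x xs with Gen._≟ⱽ_ G x c
    ... | yes _ = n≤1+n _
    ... | no  _ = ≤-refl

    count-self : ∀ x xs → count x (x ∷ xs) ≡ suc (count x xs)
    count-self x xs with Gen._≟ⱽ_ G x x
    ... | yes _ = refl
    ... | no ¬p = ⊥-elim (¬p refl)

    Few-∷ : ∀ {x m y z} {e : Edge t x m y} {π : Path y z} → Few (e ∷ π) → Few π
    Few-∷ {x} {π = π} few c = ≤-trans (count-∷ c x (sources π)) (few c)

    few-self : ∀ {x m y z} {e : Edge t x m y} {π : Path y z} → Few (e ∷ π) → count x (sources π) ≤ C
    few-self {x} {π = π} few = ≤-pred (subst (_≤ suc C) (count-self x (sources π)) (few x))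

    -- Indices count the visits still to come and so decrease along a path. A later node at the same
    -- configuration carries an index strictly below the current one, which yields distinctness.
    Earlier : V → ℕ → Node → Set
    Earlier x n w = ∀ k → w ≡ node x k → ∃ λ n′ → k ≡ clamp n′ × n′ < n

    earlier-mono : ∀ {x n n′ w} → n ≤ n′ → Earlier x n w → Earlier x n′ w
    earlier-mono le f k eq = let (n , p , lt) = f k eq in n , p , ≤-trans lt le

    -- The state `end` is excluded because the last vertex receives index `zero` without being
    -- counted among the sources.
    earlier-origin : ∀ {y j} (π : Path y (j , end)) {x} → proj₂ x ≢ end → Earlier x (count x (sources π)) (origin-of π)
    earlier-origin []      ne k refl = ⊥-elim (ne refl)
    earlier-origin {y} (e ∷ π) ne k refl = _ , refl , ≤-reflexive (≡-sym (count-self y (sources π)))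

    earlier-sources : ∀ {y j} (π : Path y (j , end)) {x} → proj₂ x ≢ end →
                      All (λ r → Earlier x (count x (sources π)) (source r)) (trace π)
    earlier-sources [] ne = []
    earlier-sources (_∷_ {x = y} e π) {x} ne =
      earlier-origin (e ∷ π) ne ∷
      All.map (earlier-mono (count-∷ x y (sources π))) (earlier-sources π ne)

    earlier-targets : ∀ {y j} (π : Path y (j , end)) {x} → proj₂ x ≢ end →
                      All (λ r → Earlier x (count x (sources π)) (target r)) (trace π)
    earlier-targets [] ne = []
    earlier-targets (_∷_ {x = y} e π) {x} ne = All.map (earlier-mono (count-∷ x y (sources π)))
      (earlier-origin π ne ∷ earlier-targets π ne)

    edge≢end : ∀ {x m y} → Edge t x m y → proj₂ x ≢ end
    edge≢end (_ , _ , _ , p , _) = no-exit p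

    not-earlier : ∀ {x n w} → n ≤ C → Earlier x n w → w ≢ node x (clamp n)
    not-earlier n≤ f refl with f _ refl
    ... | n′ , eq , lt = <-irrefl (≡-sym (clamp-injective n≤ (≤-trans (<⇒≤ lt) n≤) eq)) lt

    -- This makes the successor pointers well defined; `unique-targets` does the same for the
    -- predecessor pointers.
    unique-sources : ∀ {y j} (π : Path y (j , end)) → Few π → Unique (map source (trace π))
    unique-sources [] few = []
    unique-sources (e ∷ π) few =
      gmap⁺ (λ f eq → not-earlier (few-self {e = e} {π} few) f (≡-sym eq)) (earlier-sources π (edge≢end e))
      ∷ unique-sources π (Few-∷ {e = e} few)

    unique-nodes : ∀ {y j} (π : Path y (j , end)) → Few π → Unique (origin-of π ∷ map target (trace π))
    unique-nodes [] few = [] ∷ []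
    unique-nodes (e ∷ π) few =
      ((λ eq → not-earlier le (earlier-origin π (edge≢end e)) (≡-sym eq)) ∷
       gmap⁺ (λ f eq → not-earlier le f (≡-sym eq)) (earlier-targets π (edge≢end e)))
      ∷ unique-nodes π (Few-∷ {e = e} few)
      where le = few-self {e = e} {π} few

    unique-targets : ∀ {y j} (π : Path y (j , end)) → Few π → Unique (map target (trace π))
    unique-targets π few with unique-nodes π few
    ... | _ ∷ u = u

    record Sane (r : Entry) : Set where
      field
        {a a′}   : A
        at-src   : at t (proj₁ (source r)) ≡ just a
        at-tgt   : at t (proj₁ (target r)) ≡ just a′
        moves    : move (moved r) (proj₁ (source r)) ≡ just (proj₁ (target r))
        possible : (output r , moved r , proj₁ (proj₂ (target r))) ∈ δ (proj₁ (proj₂ (source r))) a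

    at-origin : ∀ {y j a} → Path y (j , end) → at t j ≡ just a → ∃ λ a → at t (proj₁ y) ≡ just a
    at-origin []                        o = _ , o
    at-origin ((_ , _ , p , _) ∷ _) o = _ , p

    trace-sane : ∀ {y j a} (π : Path y (j , end)) → at t j ≡ just a → All Sane (trace π)
    trace-sane []                        _ = []
    trace-sane ((a , m , p , q , mv) ∷ π) o =
      record { at-src = p ; at-tgt = proj₂ (at-origin π o) ; moves = mv ; possible = q } ∷ trace-sane π o

    _≟ᴺ_ : DecidableEquality Node
    _≟ᴺ_ = ≡-dec ℕ._≟_ (_≟_ S′-finite)

    module Labelling (rs : List Entry) where

      find : (Entry → Node) → Node → List Entry → Maybe Entry
      find key x [] = nothing
      find key x (r ∷ rs) with key r ≟ᴺ x
      ... | yes _ = just r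
      ... | no  _ = find key x rs

      find-∈ : ∀ key {r rs} → Unique (map key rs) → r ∈ rs → find key (key r) rs ≡ just r
      find-∈ key {r} _ (here refl) with key r ≟ᴺ key r
      ... | yes _ = refl
      ... | no ¬p = ⊥-elim (¬p refl)
      find-∈ key {r} {r₀ ∷ _} (u ∷ us) (there r∈) with key r₀ ≟ᴺ key r
      ... | yes eq = ⊥-elim (All.lookup u (∈-map⁺ key r∈) eq)
      ... | no  _  = find-∈ key us r∈

      forwardAt : ℕ → S′ → Maybe Forward
      forwardAt i s = Maybe.map (λ r → output r , moved r , proj₂ (target r)) (find source (i , s) rs)

      backwardAt : ℕ → S′ → Maybe Backward
      backwardAt i s = Maybe.map (λ r → opposite (moved r) , proj₂ (source r)) (find target (i , s) rs)

      label : ℕ → A → Label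
      label i a = a , tabulate (forwardAt i ∘ dec S′-finite) , tabulate (backwardAt i ∘ dec S′-finite)

      labelsFrom : ℕ → List A → List Label
      labelsFrom i []      = []
      labelsFrom i (a ∷ t) = label i a ∷ labelsFrom (suc i) t

      labels : List Label
      labels = labelsFrom 0 t

      forward-label : ∀ i a s → forward (label i a) s ≡ forwardAt i s
      forward-label i a s = trans (lookup∘tabulate _ (enc S′-finite s)) (cong (forwardAt i) (dec-enc S′-finite s))

      backward-label : ∀ i a s → backward (label i a) s ≡ backwardAt i s
      backward-label i a s = trans (lookup∘tabulate _ (enc S′-finite s)) (cong (backwardAt i) (dec-enc S′-finite s))

      at-labelsFrom : ∀ n t {i a} → at t i ≡ just a → at (labelsFrom n t) i ≡ just (label (n + i) a)
      at-labelsFrom n (a ∷ t) {zero}  refl = cong (λ i → just (label i a)) (≡-sym (+-identityʳ n))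
      at-labelsFrom n (_ ∷ t) {suc i} {a} p =
        trans (at-labelsFrom (suc n) t p) (cong (λ i → just (label i a)) (≡-sym (+-suc n i)))

      letters : ∀ n t → map letter (labelsFrom n t) ≡ t
      letters n []      = refl
      letters n (a ∷ t) = cong (a ∷_) (letters (suc n) t)

    record Link (v : List Label) (x : Node) (y : Maybe Y) (x₁ : Node) : Set where
      field
        {ℓ ℓ₁}  : Label
        {m}     : Move
        at-x    : at v (proj₁ x) ≡ just ℓ
        at-x₁   : at v (proj₁ x₁) ≡ just ℓ₁
        nexts   : next ℓ (proj₂ x) ≡ just (y , m , proj₂ x₁)
        prevs   : backward ℓ₁ (proj₂ x₁) ≡ just (opposite m , proj₂ x)
        moves   : move m (proj₁ x) ≡ just (proj₁ x₁)
        x₁≢start : proj₁ (proj₂ x₁) ≢ start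

    link : ∀ rs → Unique (map source rs) → Unique (map target rs) → All Sane rs →
           ∀ {r} → r ∈ rs → Link (Labelling.labels rs) (source r) (output r) (target r)
    link rs us ut sane {r} r∈ = record
      { at-x = at-labelsFrom 0 t at-src ; at-x₁ = at-labelsFrom 0 t at-tgt ; moves = moves
      ; nexts = trans (cong (validate a _) (trans (forward-label i a s)
                  (cong (Maybe.map _) (find-∈ source us r∈)))) (validate-complete possible)
      ; prevs = trans (backward-label (proj₁ (target r)) a′ (proj₂ (target r)))
                  (cong (Maybe.map _) (find-∈ target ut r∈))
      ; x₁≢start = no-entry possible }
      where
      open Labelling rs
      open Sane (All.lookup sane r∈)
      i = proj₁ (source r)
      s = proj₂ (source r)

    module _ (v : List Label) where

      data Done : Node → List Y → Set where
        origin : Done (0 , (start , zero)) []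
        snoc   : ∀ {x₀ y x ls} → Done x₀ ls → Link v x₀ y x → Done x (y ?∷ ls)

      data Todo : Node → List Y → Set where
        final : ∀ {i s ℓ} → at v i ≡ just ℓ → proj₁ s ≡ end → Todo (i , s) []
        cons  : ∀ {x y x₁ rs} → Link v x y x₁ → Todo x₁ rs → Todo x (y ?∷ rs)

      todo : ∀ {x j ℓ} (π : Path x (j , end)) → at v j ≡ just ℓ →
             (∀ {r} → r ∈ trace π → Link v (source r) (output r) (target r)) → Todo (origin-of π) (word π)
      todo []      o f = final o refl
      todo (e ∷ π) o f = cons (f (here refl)) (todo π o (f ∘ there))

      step-bk : ∀ {ℓ q s} → proj₁ s ≢ start → step′ ℓ (bk q , s) ≡ onBackward q (backward ℓ s)
      step-bk {s = s} ne with _≟_ (Gen.finite G) (proj₁ s) start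
      ... | yes eq = ⊥-elim (ne eq)
      ... | no  _  = refl

      step-chk : ∀ {ℓ q m s₀ s} → backward ℓ s ≡ just (opposite m , s₀) →
                 step′ ℓ (chk q m s₀ , s) ≡ go (fw q , s) [] stay
      step-chk {ℓ} {q} {m} {s₀} {s} eq
        with _≟_ (Maybe-finite Backward-finite) (backward ℓ s) (just (opposite m , s₀))
      ... | yes _ = refl
      ... | no ne = ⊥-elim (ne eq)

      step-end : ∀ {ℓ s} → proj₁ s ≡ end → step′ ℓ (drain , s) ≡ accept
      step-end {s = s} eq with _≟_ (Gen.finite G) (proj₁ s) end
      ... | yes _ = refl
      ... | no ne = ⊥-elim (ne eq)

      step-drain : ∀ {ℓ s} → proj₁ s ≢ end → step′ ℓ (drain , s) ≡ onDrain (next ℓ s)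
      step-drain {s = s} ne with _≟_ (Gen.finite G) (proj₁ s) end
      ... | yes eq = ⊥-elim (ne eq)
      ... | no  _  = refl

      open Link

      drains : ∀ {i s rs} → Todo (i , s) rs → At v (drain , s) i []
      drains (final o eq) = halt o (step-end eq)
      drains (cons l td) = act (at-x l)
        (trans (step-drain (no-exit (validate-sound _ _ (forward (ℓ l) _) (nexts l)))) (cong onDrain (nexts l)))
        (moves l) (drains td)

      checks : ∀ {x y x₁ q z} (l : Link v x y x₁) → At v (fw q , proj₂ x₁) (proj₁ x₁) z →
               At v (chk q (m l) (proj₂ x) , proj₂ x₁) (proj₁ x₁) z
      checks l r = act (at-x₁ l) (step-chk (prevs l)) refl r

      forwards : ∀ {i s ls rs q z} → Done (i , s) ls → Todo (i , s) rs →
                 Run rgt (map step ls) q (map step rs) z accepted → At v (fw q , s) i z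
      backwards : ∀ {i s ls rs q z} → Done (i , s) ls → Todo (i , s) rs →
                  Run lft (map step ls) q (map step rs) z accepted → At v (bk q , s) i z

      forwards {s = s} {q = q} dn (cons {y = nothing} l td) r =
        act (at-x l) (cong (onForward q s) (nexts l)) (moves l) (checks l (forwards (snoc dn l) td r))
      forwards {s = s} {q = q} dn (cons {y = just y} {x₁} l td) (acc p) =
        act (at-x l) (trans (cong (onForward q s) (nexts l)) (cong (onRead s (m l) (proj₂ x₁)) p)) refl
          (drains (cons l td))
      forwards {s = s} {q = q} dn (cons {y = just y} {x₁} l td) (goˢ p r) =
        act (at-x l) (trans (cong (onForward q s) (nexts l)) (cong (onRead s (m l) (proj₂ x₁)) p)) refl
          (forwards dn (cons l td) r)
      forwards {s = s} {q = q} dn (cons {y = just y} {x₁} l td) (goᴿ p r) =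
        act (at-x l) (trans (cong (onForward q s) (nexts l)) (cong (onRead s (m l) (proj₂ x₁)) p)) (moves l)
          (checks l (forwards (snoc dn l) td r))
      forwards {s = s} {q = q} dn (cons {y = just y} {x₁} l td) (goᴸ p r) =
        act (at-x l) (trans (cong (onForward q s) (nexts l)) (cong (onRead s (m l) (proj₂ x₁)) p)) refl
          (backwards dn (cons l td) r)

      backwards {s = s} {q = q} (snoc {x₀} {nothing} dn l) td r =
        act (at-x₁ l) (trans (step-bk (x₁≢start l)) (cong (onBackward q) (prevs l))) (move-opposite (m l) (moves l))
          (act (at-x l) (cong (onBack q (proj₂ x₀)) (nexts l)) refl (backwards dn (cons l td) r))
      backwards {s = s} {q = q} (snoc {x₀} {just y} dn l) td (turn r) =
        act (at-x₁ l) (trans (step-bk (x₁≢start l)) (cong (onBackward q) (prevs l))) (move-opposite (m l) (moves l))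
          (act (at-x l) (cong (onBack q (proj₂ x₀)) (nexts l)) refl (forwards dn (cons l td) r))

    sources≢start : ∀ {x y} (π : Path x y) → proj₂ x ≢ start → All (λ c → c ≢ (0 , start)) (sources π)
    sources≢start []                               ne = []
    sources≢start ((_ , _ , _ , p , _) ∷ π) ne = (λ { refl → ne refl }) ∷ sources≢start π (no-entry p)

    count-zero : ∀ c {xs} → All (λ x → x ≢ c) xs → count c xs ≡ 0
    count-zero c [] = refl
    count-zero c {x ∷ xs} (ne ∷ nes) with Gen._≟ⱽ_ G x c
    ... | yes eq = ⊥-elim (ne eq)
    ... | no  _  = count-zero c nes

    -- The machine has to know its initial index in advance. No visit to `start` is still to come,
    -- because `start` is never entered.
    index-start : ∀ {y} (π : Path (0 , start) y) → index π ≡ zero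
    index-start [] = refl
    index-start (e@(_ , _ , _ , p , _) ∷ π) = cong clamp (count-zero (0 , start) (sources≢start π (no-entry p)))

    machine-complete : ∀ {j a z} (π : Path (0 , start) (j , end)) → at t j ≡ just a → Few π →
                       DM.Accepts D (word π) z → ∃ λ v → map letter v ≡ t × DM.Accepts machine v z
    machine-complete {z = z} π o few r = labels , letters 0 t , DM.At⇒Accepts machine
      (forwards labels origin
        (subst (λ k → Todo labels (0 , (start , k)) (word π)) (index-start π)
          (todo labels π (at-labelsFrom 0 t o)
            (link (trace π) (unique-sources π few) (unique-targets π few) (trace-sane π o)))) r)
      where open Labelling (trace π)

-- Relabelled outputs of a 2gsm

BList : ℕ → Set → Set
BList zero    X = ⊤
BList (suc n) X = Maybe (X × BList n X)

module _ {X : Set} where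
  toList : ∀ {n} → BList n X → List X
  toList {zero}  _               = []
  toList {suc n} nothing         = []
  toList {suc n} (just (x , xs)) = x ∷ toList xs

  -- Truncates lists longer than the bound.
  fromList : ∀ {n} → List X → BList n X
  fromList {zero}  _        = tt
  fromList {suc n} []       = nothing
  fromList {suc n} (x ∷ xs) = just (x , fromList xs)

  toList-fromList : ∀ {n} xs → length xs ≤ n → toList (fromList {n} xs) ≡ xs
  toList-fromList {zero}  []       _        = refl
  toList-fromList {suc n} []       _        = refl
  toList-fromList {suc n} (x ∷ xs) (s≤s le) = cong (x ∷_) (toList-fromList xs le)

  raise : ∀ {n} → BList n X → BList (suc n) X
  raise {zero}  _               = nothing
  raise {suc n} nothing         = nothing
  raise {suc n} (just (x , xs)) = just (x , raise xs)

  toList-raise : ∀ {n} (xs : BList n X) → toList (raise xs) ≡ toList xs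
  toList-raise {zero}  _               = refl
  toList-raise {suc n} nothing         = refl
  toList-raise {suc n} (just (x , xs)) = cong (x ∷_) (toList-raise xs)

  pop : ∀ {n} → BList n X → Maybe (X × BList n X)
  pop {zero}  _               = nothing
  pop {suc n} nothing         = nothing
  pop {suc n} (just (x , xs)) = just (x , raise xs)

  pop-nothing : ∀ {n} (xs : BList n X) → pop xs ≡ nothing → toList xs ≡ []
  pop-nothing {zero}  _       _ = refl
  pop-nothing {suc n} nothing _ = refl

  pop-just : ∀ {n} (xs : BList n X) {x xs′} → pop xs ≡ just (x , xs′) → toList xs ≡ x ∷ toList xs′
  pop-just {suc n} (just (x , xs)) refl = cong (x ∷_) (≡-sym (toList-raise xs))

BList-finite : ∀ {X : Set} n → Finite X → Finite (BList n X)
BList-finite zero    F = ⊤-finite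
BList-finite (suc n) F = Maybe-finite (×-finite F (BList-finite n F))

tapeAt-marked : ∀ {a} (w : List (Fin a)) i → tapeAt w i ≡ at (marked w) i
tapeAt-marked w             zero          = refl
tapeAt-marked []            (suc zero)    = refl
tapeAt-marked []            (suc (suc i)) = refl
tapeAt-marked (x ∷ w)       (suc zero)    = refl
tapeAt-marked (x ∷ w)       (suc (suc i)) = tapeAt-marked w (suc i)

at-≤ : ∀ {a} (w : List (Fin a)) {i x} → at (marked w) i ≡ just x → i ≤ suc (length w)
at-≤ w       {zero}        _ = z≤n
at-≤ []      {suc zero}    _ = s≤s z≤n
at-≤ (y ∷ w) {suc zero}    _ = s≤s z≤n
at-≤ (y ∷ w) {suc (suc i)} p = s≤s (at-≤ w {suc i} p)

≤-at : ∀ {a} (w : List (Fin a)) {i} → i ≤ suc (length w) → ∃ λ x → at (marked w) i ≡ just x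
≤-at w       {zero}        _              = _ , refl
≤-at []      {suc zero}    _              = _ , refl
≤-at []      {suc (suc i)} (s≤s ())
≤-at (y ∷ w) {suc zero}    _              = _ , refl
≤-at (y ∷ w) {suc (suc i)} (s≤s le)       = ≤-at w {suc i} le

module FromGSM {a b : ℕ} (M : TwoGSM a b) {Γ : Set} (finΓ : Finite Γ) (ρ : Sym b → Γ → Bool) where
  open TwoGSM M renaming (δ to instrs)
  open Instr

  bound : List (Instr nQ a b) → ℕ
  bound []       = 0
  bound (ι ∷ ιs) = (length (α₁ ι) ⊔ length (α₀ ι)) ⊔ bound ιs

  bound-∈ : ∀ {ι ιs} → ι ∈ ιs → length (α₁ ι) ⊔ length (α₀ ι) ≤ bound ιs
  bound-∈ {ιs = ι ∷ ιs} (here refl) = m≤m⊔n _ (bound ιs)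
  bound-∈ {ιs = ι ∷ ιs} (there p)   = ≤-trans (bound-∈ p) (m≤n⊔m (length (α₁ ι) ⊔ length (α₀ ι)) _)

  Buffer : Set
  Buffer = BList (bound instrs) (Fin b)

  -- The generator writes the relabelled output of M letter by letter; the buffer is what M has output so far
  -- but is still to be written.
  data GState : Set where
    begin end : GState
    run       : Fin nQ → Buffer → GState

  GState-finite : Finite GState
  GState-finite = retract-finite to from from-to
    (Maybe-finite (Maybe-finite (×-finite (Fin-finite nQ) (BList-finite _ (Fin-finite b)))))
    where
    to : GState → Maybe (Maybe (Fin nQ × Buffer))
    to begin     = nothing
    to end       = just nothing
    to (run q β) = just (just (q , β))

    from : Maybe (Maybe (Fin nQ × Buffer)) → GState
    from nothing               = begin
    from (just nothing)        = end
    from (just (just (q , β))) = run q β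

    from-to : ∀ s → from (to s) ≡ s
    from-to begin     = refl
    from-to end       = refl
    from-to (run q β) = refl

  images : Sym b → List Γ
  images τ = filter (T? ∘ ρ τ) (map (dec finΓ) (allFin (size finΓ)))

  images-sound : ∀ {τ γ} → γ ∈ images τ → T (ρ τ γ)
  images-sound {τ} p = proj₂ (∈-filter⁻ (T? ∘ ρ τ) {xs = map (dec finΓ) (allFin (size finΓ))} p)

  images-complete : ∀ {τ γ} → T (ρ τ γ) → γ ∈ images τ
  images-complete {τ} {γ} p = ∈-filter⁺ (T? ∘ ρ τ)
    (subst (_∈ map (dec finΓ) (allFin (size finΓ))) (dec-enc finΓ γ) (∈-map⁺ (dec finΓ) (∈-allFin (enc finΓ γ)))) p

  Transition : Set
  Transition = Maybe Γ × Move × GState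

  write : Sym b → GState → List Transition
  write τ s = map (λ γ → just γ , stay , s) (images τ)

  taken : Instr nQ a b → Bool → Transition
  taken ι true  = nothing , ε₁ ι , run (q₁ ι) (fromList (α₁ ι))
  taken ι false = nothing , ε₀ ι , run (q₀ ι) (fromList (α₀ ι))

  fire : Fin nQ → Sym a → Instr nQ a b → List Transition
  fire q τ ι with src ι Fin.≟ q
  ... | yes _ = taken ι (does (_≟_ (Sym-finite a) τ (σ ι))) ∷ []
  ... | no  _ = []

  finish : Fin nQ → List Transition
  finish q with q Fin.≟ q-f
  ... | yes _ = write ⊣ end
  ... | no  _ = []

  work : Fin nQ → Maybe (Fin b × Buffer) → Sym a → List Transition
  work q (just (x , β)) τ = write (sym x) (run q β)
  work q nothing        τ = finish q ++ concatMap (fire q τ) instrs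

  -- The relabelling that follows M applies to `marked z`, so images of both endmarkers are written
  -- around the output.
  trans-δ : GState → Sym a → List Transition
  trans-δ begin     τ = write ⊢ (run q-in (fromList []))
  trans-δ end       τ = []
  trans-δ (run q β) τ = work q (pop β) τ

  write-sound : ∀ {τ s x} → x ∈ write τ s → ∃ λ γ → T (ρ τ γ) × x ≡ (just γ , stay , s)
  write-sound {τ} {s} p with ∈-map⁻ (λ γ → just γ , stay , s) p
  ... | γ , q , eq = γ , images-sound {τ} q , eq

  write-complete : ∀ {τ s γ} → T (ρ τ γ) → (just γ , stay , s) ∈ write τ s
  write-complete {τ} {s} p = ∈-map⁺ (λ γ → just γ , stay , s) (images-complete p)

  data Work (q : Fin nQ) (τ : Sym a) : Transition → Set where
    finished : ∀ {γ} → q ≡ q-f → T (ρ ⊣ γ) → Work q τ (just γ , stay , end)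
    fired-eq : ∀ {ι} → ι ∈ instrs → src ι ≡ q → τ ≡ σ ι → Work q τ (taken ι true)
    fired-ne : ∀ {ι} → ι ∈ instrs → src ι ≡ q → τ ≢ σ ι → Work q τ (taken ι false)

  finish-sound : ∀ {q τ x} → x ∈ finish q → Work q τ x
  finish-sound {q} p with q Fin.≟ q-f
  ... | yes eq with write-sound {⊣} {end} p
  ...   | _ , r , refl = finished eq r

  fire-sound : ∀ {q τ ι x} → ι ∈ instrs → x ∈ fire q τ ι → Work q τ x
  fire-sound {q} {τ} {ι} ι∈ p with src ι Fin.≟ q
  fire-sound {q} {τ} {ι} ι∈ (here refl) | yes eq = taken-sound (_≟_ (Sym-finite a) τ (σ ι))
    where
    taken-sound : (d : Dec (τ ≡ σ ι)) → Work q τ (taken ι (does d))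
    taken-sound (yes e) = fired-eq ι∈ eq e
    taken-sound (no ne) = fired-ne ι∈ eq ne

  work-sound : ∀ {q τ x} → x ∈ work q nothing τ → Work q τ x
  work-sound {q} {τ} {x} p with ∈-++⁻ (finish q) p
  ... | inj₁ r = finish-sound r
  ... | inj₂ r = from-fire instrs (λ i → i) r
    where
    from-fire : ∀ ιs → (∀ {ι} → ι ∈ ιs → ι ∈ instrs) → x ∈ concatMap (fire q τ) ιs → Work q τ x
    from-fire (ι ∷ ιs) sub r with ∈-++⁻ (fire q τ ι) r
    ... | inj₁ r′ = fire-sound (sub (here refl)) r′
    ... | inj₂ r′ = from-fire ιs (sub ∘ there) r′

  fire-complete : ∀ {q τ ι} → src ι ≡ q → taken ι (does (_≟_ (Sym-finite a) τ (σ ι))) ∈ fire q τ ι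
  fire-complete {q} {τ} {ι} eq with src ι Fin.≟ q
  ... | yes _ = here refl
  ... | no ne = ⊥-elim (ne eq)

  in-work : ∀ {q τ ι x} → ι ∈ instrs → x ∈ fire q τ ι → x ∈ work q nothing τ
  in-work {q} {τ} {ι} {x} ι∈ p = ∈-++⁺ʳ (finish q) (into ι∈)
    where
    into : ∀ {ιs} → ι ∈ ιs → x ∈ concatMap (fire q τ) ιs
    into (here refl) = ∈-++⁺ˡ p
    into {ι′ ∷ _} (there r) = ∈-++⁺ʳ (fire q τ ι′) (into r)

  work-complete : ∀ {q τ x} → Work q τ x → x ∈ work q nothing τ
  work-complete {q} (finished eq r) = ∈-++⁺ˡ inside
    where
    inside : (just _ , stay , end) ∈ finish q
    inside with q Fin.≟ q-f
    ... | yes _ = write-complete r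
    ... | no ne = ⊥-elim (ne eq)
  work-complete {q} {τ} (fired-eq {ι} ι∈ eq e) = in-work ι∈
    (subst (λ b → taken ι b ∈ fire q τ ι) (dec-true (_≟_ (Sym-finite a) τ (σ ι)) e) (fire-complete eq))
  work-complete {q} {τ} (fired-ne {ι} ι∈ eq ne) = in-work ι∈
    (subst (λ b → taken ι b ∈ fire q τ ι) (dec-false (_≟_ (Sym-finite a) τ (σ ι)) ne) (fire-complete eq))

  work-target : ∀ {q τ y m s} → Work q τ (y , m , s) → s ≢ begin
  work-target (finished _ _)   ()
  work-target (fired-eq _ _ _) ()
  work-target (fired-ne _ _ _) ()

  write-target : ∀ {τ s y m s′} → (y , m , s′) ∈ write τ s → s′ ≡ s
  write-target {τ} {s} p with write-sound {τ} {s} p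
  ... | _ , _ , refl = refl

  generator : Gen (Sym a) Γ
  generator = record
    { S = GState ; finite = GState-finite ; δ = trans-δ ; start = begin ; end = end
    ; no-entry = λ {s} {τ} → no-entry {s} {τ} ; no-exit = no-exit }
    where
    no-entry : ∀ {s τ y m s′} → (y , m , s′) ∈ trans-δ s τ → s′ ≢ begin
    no-entry {begin} p eq with trans (≡-sym eq) (write-target {⊢} p)
    ... | ()
    no-entry {run q β} p eq with pop β
    no-entry {run q β} p eq | just (x , β′) with trans (≡-sym eq) (write-target {sym x} p)
    ... | ()
    no-entry {run q β} p eq | nothing = work-target (work-sound p) eq

    no-exit : ∀ {s τ y m s′} → (y , m , s′) ∈ trans-δ s τ → s ≢ end
    no-exit {end} () refl

  module _ (w : List (Fin a)) where
    open Gen generator using (Edge)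
    open Paths (Edge (marked w))

    Written : List (Fin b) → List Γ → Set
    Written x t = Relabel ρ (map sym x ∷ʳ ⊣) t

    -- A step of M must arrive on the tape, while an edge only leaves from it. A path that has yet
    -- to reach `end` has a further edge, which supplies the missing bound.
    on-tape : ∀ {i q β j} → Path (i , run q β) (j , end) → i ≤ suc (length w)
    on-tape ((_ , _ , p , _) ∷ _) = at-≤ w p

    run-sound : ∀ {i q β j} (π : Path (i , run q β) (j , end)) →
                ∃₂ λ z j′ → Steps M w (q , i) z (q-f , j′) × Written (toList β ++ z) (word π)
    run-sound {β = β} ((τ , m , p , d , mv) ∷ π) with pop β in pβ
    ... | just (x , β′) with write-sound {sym x} d
    run-sound {β = β} ((τ , m , p , d , refl) ∷ π) | just (x , β′) | γ , r , refl =
      let (z , j′ , st , wr) = run-sound π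
      in z , j′ , st , subst (λ l → Written (l ++ z) (γ ∷ word π)) (≡-sym (pop-just β pβ)) (r ∷ wr)
    run-sound {i} {β = β} ((τ , m , p , d , mv) ∷ π) | nothing with work-sound d
    run-sound {i} {β = β} ((τ , m , p , d , refl) ∷ []) | nothing | finished refl r =
      [] , i , done , subst (λ l → Written (l ++ []) _) (≡-sym (pop-nothing β pβ)) (r ∷ [])
    run-sound {i} {β = β} ((τ , m , p , d , refl) ∷ (_ , _ , _ , () , _) ∷ _) | nothing | finished refl r
    run-sound {i} {β = β} ((τ , m , p , d , mv) ∷ π) | nothing | fired-eq {ι} ι∈ refl refl =
      let (z , j′ , st , wr) = run-sound π
      in _ , j′ , step-eq ι∈ (trans (tapeAt-marked w i) p) mv (on-tape π) ∷ st
         , subst₂ (λ l l′ → Written (l ++ l′ ++ z) (word π)) (≡-sym (pop-nothing β pβ))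
             (toList-fromList (α₁ ι) (≤-trans (m≤m⊔n _ _) (bound-∈ ι∈))) wr
    run-sound {i} {β = β} ((τ , m , p , d , mv) ∷ π) | nothing | fired-ne {ι} ι∈ refl ne =
      let (z , j′ , st , wr) = run-sound π
      in _ , j′ , step-neq ι∈ (trans (tapeAt-marked w i) p) ne mv (on-tape π) ∷ st
         , subst₂ (λ l l′ → Written (l ++ l′ ++ z) (word π)) (≡-sym (pop-nothing β pβ))
             (toList-fromList (α₀ ι) (≤-trans (m≤n⊔m (length (α₁ ι)) _) (bound-∈ ι∈))) wr

    generator-sound : ∀ {j} (π : Path (0 , begin) (j , end)) →
                      ∃ λ z → Realized M w z × Relabel ρ (marked z) (word π)
    generator-sound ((τ , m , p , d , mv) ∷ π) with write-sound {⊢} d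
    generator-sound ((τ , m , p , d , refl) ∷ π) | γ , r , refl =
      let (z , j′ , st , wr) = run-sound π
      in z , (j′ , st) , r ∷ subst (λ l → Written (l ++ z) (word π)) (toList-fromList {n = bound instrs} [] z≤n) wr

    record Writes (i : ℕ) (s : GState) (t : List Γ) : Set where
      constructor writes
      field
        {j}   : ℕ
        {τ}   : Sym a
        path  : Path (i , s) (j , end)
        words : word path ≡ t
        onto  : at (marked w) j ≡ just τ

    -- The buffer returned by `pop` is not a structural part of its argument, hence the recursion on
    -- the length `n`. The argument `k` continues once the buffer is empty.
    flush : ∀ n {i q β z t} → length (toList β) ≡ n → i ≤ suc (length w) → Written (toList β ++ z) t →
            (∀ β′ {t} → pop β′ ≡ nothing → Written z t → Writes i (run q β′) t) → Writes i (run q β) t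
    flush n {i} {q} {β} {z} {t} eq le wr k with pop β in pβ
    ... | nothing = k β pβ (subst (λ l → Written (l ++ z) t) (pop-nothing β pβ) wr)
    flush n {β = β} {z} {t} eq le wr k | just (x , β′)
      with subst (λ l → Written (l ++ z) t) (pop-just β pβ) wr
    flush zero    {β = β} eq le wr k | just (x , β′) | _ with trans (≡-sym eq) (cong length (pop-just β pβ))
    ... | ()
    flush (suc n) {i} {q} {β} {t = γ ∷ _} eq le wr k | just (x , β′) | r ∷ wr′
      with flush n {β = β′} (suc-injective (trans (≡-sym (cong length (pop-just β pβ))) eq)) le wr′ k
    ... | writes π refl o = writes
          ((proj₁ (≤-at w le) , stay , proj₂ (≤-at w le) ,
            subst (λ p → (just γ , stay , run q β′) ∈ work q p (proj₁ (≤-at w le))) (≡-sym pβ) (write-complete {sym x} r) , refl) ∷ π) refl o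

    run-complete : ∀ {q i z j β t} → Steps M w (q , i) z (q-f , j) → i ≤ suc (length w) → pop β ≡ nothing →
                   Written z t → Writes i (run q β) t
    run-complete {q} {β = β} {t = γ ∷ []} done le pβ (r ∷ []) = writes
      ((_ , stay , proj₂ (≤-at w le) ,
        subst (λ p → (just γ , stay , end) ∈ work q p (proj₁ (≤-at w le))) (≡-sym pβ) (work-complete (finished refl r)) , refl) ∷ [])
      refl (proj₂ (≤-at w le))
    run-complete {t = _ ∷ _ ∷ _} done le pβ (_ ∷ ())
    run-complete {β = β} {t = t} (step-eq {ι} {i} ι∈ p mv le′ ∷ st) le pβ wr
      with flush _ {β = fromList (α₁ ι)} {t = t} refl le′
             (subst (λ l → Written (l ++ _) _) (≡-sym (toList-fromList (α₁ ι) (≤-trans (m≤m⊔n _ _) (bound-∈ ι∈)))) wr)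
             (λ β′ pβ′ wr′ → run-complete st le′ pβ′ wr′)
    ... | writes π refl o = writes
          ((_ , ε₁ ι , trans (≡-sym (tapeAt-marked w i)) p ,
            subst (λ p → taken ι true ∈ work _ p (σ ι)) (≡-sym pβ) (work-complete (fired-eq ι∈ refl refl)) , mv) ∷ π) refl o
    run-complete {β = β} {t = t} (step-neq {ι} {i} {τ = τ} ι∈ p ne mv le′ ∷ st) le pβ wr
      with flush _ {β = fromList (α₀ ι)} {t = t} refl le′
             (subst (λ l → Written (l ++ _) _)
               (≡-sym (toList-fromList (α₀ ι) (≤-trans (m≤n⊔m (length (α₁ ι)) _) (bound-∈ ι∈)))) wr)
             (λ β′ pβ′ wr′ → run-complete st le′ pβ′ wr′)
    ... | writes π refl o = writes
          ((_ , ε₀ ι , trans (≡-sym (tapeAt-marked w i)) p ,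
            subst (λ p → taken ι false ∈ work _ p τ) (≡-sym pβ) (work-complete (fired-ne ι∈ refl ne)) , mv) ∷ π) refl o

    generator-complete : ∀ {z t} → Realized M w z → Relabel ρ (marked z) t → Writes 0 begin t
    generator-complete {z} {_ ∷ t} (j , st) (r ∷ wr)
      with flush _ {q = q-in} {β = fromList []} {t = t} refl z≤n
             (subst (λ l → Written (l ++ z) _) (≡-sym (toList-fromList {n = bound instrs} [] z≤n)) wr)
             (λ β′ pβ′ wr′ → run-complete st z≤n pβ′ wr′)
    ... | writes π refl o = writes ((⊢ , stay , refl , write-complete {⊢} r , refl) ∷ π) refl o

-- Deterministic machines as 2gsm's

sym-injective : ∀ {n} {x y : Fin n} → _≡_ {A = Sym n} (sym x) (sym y) → x ≡ y
sym-injective refl = refl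

at-≤-length : ∀ {A : Set} (xs : List A) {i x} → at xs i ≡ just x → i ≤ length xs
at-≤-length (x ∷ xs) {zero}  _ = z≤n
at-≤-length (x ∷ xs) {suc i} p = s≤s (at-≤-length xs p)

tapeAt-sym : ∀ {c} (v : List (Fin c)) {i x} → at v i ≡ just x → tapeAt v (suc i) ≡ just (sym x)
tapeAt-sym (x ∷ v) {zero}  refl = refl
tapeAt-sym (x ∷ v) {suc i} p    = tapeAt-sym v p

tapeAt-sym⁻ : ∀ {c} (v : List (Fin c)) {p x} → tapeAt v p ≡ just (sym x) → ∃ λ i → p ≡ suc i × at v i ≡ just x
tapeAt-sym⁻ []      {suc zero}    ()
tapeAt-sym⁻ []      {suc (suc _)} ()
tapeAt-sym⁻ (x ∷ v) {suc zero}    refl = zero , refl , refl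
tapeAt-sym⁻ (x ∷ v) {suc (suc i)} p with tapeAt-sym⁻ v {suc i} p
... | _ , refl , q = suc i , refl , q

-- A 2gsm instruction tests for one letter only, so the letters are tried one after the other.
module Compile {c b : ℕ} (D : DM (Fin c) b) where
  open DM D using (Q; step; At; halt; act)

  data CState : Set where
    begin final : CState
    test        : Q → Fin (suc c) → CState

  CState-finite : Finite CState
  CState-finite = retract-finite to from from-to
    (Maybe-finite (Maybe-finite (×-finite (DM.finite D) (Fin-finite (suc c)))))
    where
    to : CState → Maybe (Maybe (Q × Fin (suc c)))
    to begin      = nothing
    to final      = just nothing
    to (test q j) = just (just (q , j))

    from : Maybe (Maybe (Q × Fin (suc c))) → CState
    from nothing               = begin
    from (just nothing)        = final
    from (just (just (q , j))) = test q j

    from-to : ∀ s → from (to s) ≡ s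
    from-to begin      = refl
    from-to final      = refl
    from-to (test q j) = refl

  N : ℕ
  N = size CState-finite

  ⟨_⟩ : CState → Fin N
  ⟨_⟩ = enc CState-finite

  startInstr : Instr N c b
  startInstr = instr ⟨ begin ⟩ ⊢ ⟨ test (DM.start D) zero ⟩ [] right ⟨ begin ⟩ [] stay

  -- No instruction starts in `test q (fromℕ c)`. It is the dead state for `stop`, and also where
  -- all tests having failed on an endmarker leads.
  hit : Q → Act Q (Fin b) → CState
  hit q stop         = test q (fromℕ c)
  hit q accept       = final
  hit q (go q′ _ _)  = test q′ zero

  out : Act Q (Fin b) → List (Fin b)
  out stop       = []
  out accept     = []
  out (go _ α _) = α

  heading : Act Q (Fin b) → Move
  heading stop       = stay
  heading accept     = stay
  heading (go _ _ m) = m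

  testInstr : Q → Fin c → Instr N c b
  testInstr q τ = instr ⟨ test q (inject₁ τ) ⟩ (sym τ) ⟨ hit q (step τ q) ⟩ (out (step τ q)) (heading (step τ q))
                        ⟨ test q (suc τ) ⟩ [] stay

  states : List Q
  states = map (dec (DM.finite D)) (allFin (size (DM.finite D)))

  ∈-states : ∀ q → q ∈ states
  ∈-states q = subst (_∈ states) (dec-enc (DM.finite D) q) (∈-map⁺ (dec (DM.finite D)) (∈-allFin (enc (DM.finite D) q)))

  program : List (Instr N c b)
  program = startInstr ∷ cartesianProductWith testInstr states (allFin c)

  data Listed : Instr N c b → Set where
    starts : Listed startInstr
    tests  : ∀ q τ → Listed (testInstr q τ)

  listed : ∀ {ι} → ι ∈ program → Listed ι
  listed (here refl) = starts
  listed (there p) with ∈-cartesianProductWith⁻ testInstr states (allFin c) p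
  ... | q , τ , _ , _ , refl = tests q τ

  tests-∈ : ∀ q τ → testInstr q τ ∈ program
  tests-∈ q τ = there (∈-cartesianProductWith⁺ testInstr (∈-states q) (∈-allFin τ))

  code-injective : ∀ {s t} → ⟨ s ⟩ ≡ ⟨ t ⟩ → s ≡ t
  code-injective = enc-injective CState-finite

  gsm : TwoGSM c b
  gsm = record { nQ = N ; δ = program ; q-in = ⟨ begin ⟩ ; q-f = ⟨ final ⟩ ; src≢f = src≢f }
    where
    src≢f : ∀ {ι} → ι ∈ program → Instr.src ι ≢ ⟨ final ⟩
    src≢f ι∈ eq with listed ι∈
    ... | starts    with () ← code-injective eq
    ... | tests q τ with () ← code-injective eq

  test-injective : ∀ {q q′ j j′} → test q j ≡ test q′ j′ → q ≡ q′ × j ≡ j′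
  test-injective refl = refl , refl

  gsm-deterministic : Deterministic gsm
  gsm-deterministic ι∈ ι′∈ eq with listed ι∈ | listed ι′∈
  ... | starts    | starts      = refl
  ... | starts    | tests q τ   with () ← code-injective eq
  ... | tests q τ | starts      with () ← code-injective eq
  ... | tests q τ | tests q′ τ′ with test-injective (code-injective eq)
  ...   | refl , eq′ with refl ← Fin.inject₁-injective eq′ = refl

  module _ (v : List (Fin c)) where

    from-final : ∀ {x p z p′} → x ≡ ⟨ final ⟩ → Steps gsm v (x , p) z (⟨ final ⟩ , p′) → z ≡ []
    from-final eq done = refl
    from-final eq (step-eq ι∈ _ _ _ ∷ _)    = ⊥-elim (TwoGSM.src≢f gsm ι∈ eq)
    from-final eq (step-neq ι∈ _ _ _ _ ∷ _) = ⊥-elim (TwoGSM.src≢f gsm ι∈ eq)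

    move-suc : ∀ m {i j} → move m (suc i) ≡ just (suc j) → move m i ≡ just j
    move-suc left  {suc i} refl = refl
    move-suc stay  refl = refl
    move-suc right refl = refl

    suc-move : ∀ m {i j} → move m i ≡ just j → move m (suc i) ≡ just (suc j)
    suc-move left {suc i} refl = refl
    suc-move stay  refl = refl
    suc-move right refl = refl

    -- Positions are shifted by one because of the left endmarker. Only a successful test leads on
    -- to `final`, so the head must be scanning a letter.
    steps-sound : ∀ {x q j p z p′} → x ≡ ⟨ test q j ⟩ → Steps gsm v (x , p) z (⟨ final ⟩ , p′) →
                  ∃ λ i → p ≡ suc i × At v q i z
    steps-sound eq done with () ← code-injective eq
    steps-sound eq (step-eq ι∈ _ _ _ ∷ _) with listed ι∈
    steps-sound eq (step-eq ι∈ _ _ _ ∷ _) | starts with () ← code-injective eq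
    steps-sound {p = p} eq (step-eq ι∈ p≡ mv le ∷ st) | tests q τ with test-injective (code-injective eq) | tapeAt-sym⁻ v {p} p≡
    ... | refl , _ | i , refl , at-i with step τ q in st-eq
    -- The dead state is again a `test q` at the same position, so the recursive call settles the
    -- case without showing that the machine is stuck.
    ...   | stop with refl ← mv = steps-sound refl st
    ...   | accept with refl ← from-final refl st = i , refl , halt at-i st-eq
    ...   | go q′ α m with steps-sound refl st
    ...     | i′ , refl , r = i , refl , act at-i st-eq (move-suc m mv) r
    steps-sound eq (step-neq ι∈ _ _ _ _ ∷ _) with listed ι∈
    steps-sound eq (step-neq ι∈ _ _ _ _ ∷ _) | starts with () ← code-injective eq
    steps-sound eq (step-neq ι∈ p≡ ne refl le ∷ st) | tests q τ with test-injective (code-injective eq)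
    ... | refl , _ = steps-sound refl st

    gsm-sound : ∀ {z} → Realized gsm v z → DM.Accepts D v z
    gsm-sound (j , st) = DM.At⇒Accepts D (first refl st)
      where
      first : ∀ {x z p′} → x ≡ ⟨ begin ⟩ → Steps gsm v (x , 0) z (⟨ final ⟩ , p′) → At v (DM.start D) 0 z
      first eq done with () ← code-injective eq
      first eq (step-eq ι∈ _ _ _ ∷ _) with listed ι∈
      first eq (step-eq ι∈ _ refl _ ∷ st) | starts with steps-sound refl st
      ... | _ , refl , r = r
      first eq (step-eq ι∈ _ _ _ ∷ _) | tests q τ with () ← code-injective eq
      first eq (step-neq ι∈ _ _ _ _ ∷ _) with listed ι∈
      first eq (step-neq ι∈ refl ne _ _ ∷ st) | starts = ⊥-elim (ne refl)
      first eq (step-neq ι∈ _ _ _ _ ∷ _) | tests q τ with () ← code-injective eq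

    seek : ∀ {q i τ z cf} n j → at v i ≡ just τ → n + toℕ j ≡ toℕ τ →
           Steps gsm v (⟨ test q (inject₁ τ) ⟩ , suc i) z cf → Steps gsm v (⟨ test q j ⟩ , suc i) z cf
    seek {τ = τ} zero j at-i eq st
      with refl ← Fin.toℕ-injective {i = j} {inject₁ τ} (trans eq (≡-sym (Fin.toℕ-inject₁ τ))) = st
    seek {q} {i} {τ} {z} {cf} (suc n) j at-i eq st =
      subst (λ j → Steps gsm v (⟨ test q j ⟩ , suc i) z cf) k≡j
        (step-neq (tests-∈ q k) (tapeAt-sym v at-i) (λ e → <-irrefl (cong toℕ (≡-sym (sym-injective e))) k<τ) refl (s≤s (at-≤-length v at-i))
          ∷ seek n (suc k) at-i (trans (+-suc n (toℕ k)) (trans (cong (λ x → suc (n + x)) (Fin.toℕ-fromℕ< j<c)) eq)) st)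
      where
      j<τ : toℕ j < toℕ τ
      j<τ = ≤-trans (s≤s (m≤n+m (toℕ j) n)) (≤-reflexive eq)
      j<c : toℕ j < c
      j<c = <-trans j<τ (Fin.toℕ<n τ)
      k : Fin c
      k = fromℕ< j<c
      k<τ : toℕ k < toℕ τ
      k<τ = subst (_< toℕ τ) (≡-sym (Fin.toℕ-fromℕ< j<c)) j<τ
      k≡j : inject₁ k ≡ j
      k≡j = Fin.toℕ-injective (trans (Fin.toℕ-inject₁ k) (Fin.toℕ-fromℕ< j<c))

    at-pos : ∀ {q i z} → At v q i z → i ≤ length v
    at-pos (halt p _)    = at-≤-length v p
    at-pos (act p _ _ _) = at-≤-length v p

    found : ∀ {q i τ a β p cf} → at v i ≡ just τ → step τ q ≡ a → move (heading a) (suc i) ≡ just p → p ≤ suc (length v) →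
            Steps gsm v (⟨ hit q a ⟩ , p) β cf → Steps gsm v (⟨ test q zero ⟩ , suc i) (out a ++ β) cf
    found {q} {i} {τ} at-i refl mv le st =
      seek (toℕ τ) zero at-i (+-identityʳ _) (step-eq (tests-∈ q τ) (tapeAt-sym v at-i) mv le ∷ st)

    steps-complete : ∀ {q i z} → At v q i z → ∃ λ p → Steps gsm v (⟨ test q zero ⟩ , suc i) z (⟨ final ⟩ , p)
    steps-complete (halt at-i eq) = _ , found at-i eq refl (s≤s (at-≤-length v at-i)) done
    steps-complete (act {m = m} at-i eq mv r) =
      let (p , st) = steps-complete r in p , found at-i eq (suc-move m mv) (s≤s (at-pos r)) st

    gsm-complete : ∀ {z} → DM.Accepts D v z → Realized gsm v z
    gsm-complete r = let (p , st) = steps-complete (DM.Accepts⇒At D r)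
                     in p , step-eq (here refl) refl refl (s≤s z≤n) ∷ st

-- Compositions

-- The machine never computes more than R, and computes all of R w whenever R w is finite.
record Good {a b : ℕ} (R : Rel a b) : Set₁ where
  field
    {Γ}      : Set
    finite   : Finite Γ
    ρ        : Sym a → Γ → Bool
    machine  : DM Γ b
    sound    : ∀ {w v z} → Relabel ρ (marked w) v → DM.Accepts machine v z → R w z
    complete : ∀ {w n} → (∀ {z} → R w z → length z ≤ n) →
               ∀ {z} → R w z → ∃ λ v → Relabel ρ (marked w) v × DM.Accepts machine v z

Good-≐ : ∀ {a b} {R S : Rel a b} → R ≐ S → Good S → Good R
Good-≐ e G = record
  { finite = finite ; ρ = ρ ; machine = machine
  ; sound = λ r s → Equivalence.from (e _ _) (sound r s)
  ; complete = λ bound r → complete (λ s → bound (Equivalence.from (e _ _) s)) (Equivalence.to (e _ _) r) }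
  where open Good G

module Letters {X Y : Set} (F : Finite X) (f : Y → X) where
  same : X → Y → Bool
  same x y = isYes (_≟_ F x (f y))

  relabel-sound : ∀ {xs ys} → Relabel same xs ys → map f ys ≡ xs
  relabel-sound []      = refl
  relabel-sound (p ∷ r) = cong₂ _∷_ (≡-sym (toWitness p)) (relabel-sound r)

  relabel-complete : ∀ {xs} ys → map f ys ≡ xs → Relabel same xs ys
  relabel-complete []       refl = []
  relabel-complete (y ∷ ys) refl = fromWitness refl ∷ relabel-complete ys refl

module Copy (b : ℕ) where
  copy : Sym b → ⊤ → Act ⊤ (Fin b)
  copy ⊢       _ = go tt [] right
  copy (sym x) _ = go tt (x ∷ []) right
  copy ⊣       _ = accept

  copier : DM (Sym b) b
  copier = record { Q = ⊤ ; finite = ⊤-finite ; start = tt ; step = copy }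

  open DM copier using (Run; acc; goᴿ)

  copies : ∀ w {ls} → Run rgt ls tt (map copy (map sym w ∷ʳ ⊣)) w accepted
  copies []      = acc refl
  copies (x ∷ w) = goᴿ refl (copies w)

  copier-accepts : ∀ w → DM.Accepts copier (marked w) w
  copier-accepts w = goᴿ refl (copies w)

  open Letters (Sym-finite b) id

  -- The base of the induction: a single 2gsm is treated as its composition with the identity, so
  -- `Good-⨾` is the only real construction.
  Good-id : Good {b} {b} _≡_
  Good-id = record
    { finite = Sym-finite b ; ρ = same ; machine = copier
    ; sound = λ {w} {v} {z} r s → unique w (subst (λ v → DM.Accepts copier v z)
        (trans (≡-sym (map-id v)) (relabel-sound r)) s)
    ; complete = λ { {w} _ refl → marked w , relabel-complete (marked w) (map-id (marked w)) , copier-accepts w } }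
    where
    unique : ∀ w {z} → DM.Accepts copier (marked w) z → w ≡ z
    unique w s = proj₁ (DM.Run-unique copier (copier-accepts w) s)

module Compose {a b c : ℕ} (M : TwoGSM a b) {R : Rel b c} (G : Good R) where
  private module G = Good G
  open FromGSM M G.finite G.ρ
  open Gen generator using (Edge; _≟ⱽ_)

  -- This agrees with `maxLoops` by unfolding. It depends on the machine for `R` alone, so one label
  -- alphabet serves all inputs.
  C : ℕ
  C = (classes * classes) * classes
    where open Tables {B = Fin c} (DM.finite G.machine) using (classes)

  open Simulation (Sym-finite a) G.finite generator G.machine C
  open Letters (Sym-finite a) letter

  module _ (w : List (Fin a)) where
    open Paths (Edge (marked w))
    open Visits _≟ⱽ_
    open DecMembership _≟ⱽ_ using (_∈?_)
    open Cut (DM.finite G.machine) (DM.start G.machine) (DM.step G.machine) _≟ⱽ_ (Edge (marked w)) using (bounded-visits)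

    count-∉ : ∀ c xs → ¬ (c ∈ xs) → count c xs ≡ 0
    count-∉ c []       _ = refl
    count-∉ c (x ∷ xs) ∉ with x ≟ⱽ c
    ... | yes refl = ⊥-elim (∉ (here refl))
    ... | no  _    = count-∉ c xs (∉ ∘ there)

    -- Besides soundness this gives `Bounded`: a pumped path also produces an output of the
    -- composition at `w`, so the bound there applies to it.
    path-sound : ∀ {j z} (π : Path (0 , begin) (j , end)) → DM.Accepts G.machine (word π) z → (Realized M ⨾ R) w z
    path-sound π r = let (w₂ , m , wr) = generator-sound w π in w₂ , m , G.sound wr r

    compose-complete : ∀ {n} → (∀ {z} → (Realized M ⨾ R) w z → length z ≤ n) →
      ∀ {z} → (Realized M ⨾ R) w z → ∃ λ v → Relabel same (marked w) v × DM.Accepts machine v z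
    compose-complete bound (w₂ , m , r) with G.complete (λ s → bound (w₂ , m , s)) r
    ... | t , wr , run₀ with generator-complete w m wr
    ...   | writes π refl onto with bounded-visits (λ π → bound ∘ path-sound π) π run₀
    ...     | π′ , run₁ , few with Complete.machine-complete (marked w) π′ onto every run₁
      where
      every : ∀ c → count c (sources π′) ≤ suc C
      every c with count c (sources π′) in eq
      ... | zero  = z≤n
      ... | suc n with c ∈? sources π′
      ...   | yes c∈ = subst (_≤ suc C) eq (All.lookup few c∈)
      ...   | no  c∉ with () ← trans (≡-sym eq) (count-∉ c (sources π′) c∉)
    ...       | v , eq , run₂ = v , relabel-complete v eq , run₂

  Good-⨾ : Good (Realized M ⨾ R)
  Good-⨾ = record
    { finite = Label-finite ; ρ = same ; machine = machine ; sound = sound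
    ; complete = λ {w} bound r → compose-complete w bound r }
    where
    sound : ∀ {w v z} → Relabel same (marked w) v → DM.Accepts machine v z → (Realized M ⨾ R) w z
    sound {w} {v} {z} r s with Sound.machine-sound v s
    ... | j , π , s′ = along (relabel-sound r) π s′
      where
      along : ∀ {t} → t ≡ marked w → (π : Paths.Path (Edge t) (0 , begin) (j , end)) →
              DM.Accepts G.machine (Paths.word (Edge t) π) z → (Realized M ⨾ R) w z
      along refl = path-sound w

NGSM^⇒Good : ∀ k {a b} {R : Rel a b} → (NGSM ^ k) a b R → Good R
NGSM^⇒Good zero    ()
NGSM^⇒Good (suc zero) {b = b} (ngsm M e) = Good-≐ (λ w z → mk⇔
  (λ r → z , Equivalence.to (e w z) r , refl)
  (λ { (_ , r , refl) → Equivalence.from (e w z) r })) (Compose.Good-⨾ M (Copy.Good-id b))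
NGSM^⇒Good (suc (suc k)) (comp R₁ R₂ (ngsm M e₁) h e) = Good-≐ (λ w z → mk⇔
  (λ r → let (w₂ , r₁ , r₂) = Equivalence.to (e w z) r in w₂ , Equivalence.to (e₁ w w₂) r₁ , r₂)
  (λ { (w₂ , r₁ , r₂) → Equivalence.from (e w z) (w₂ , Equivalence.from (e₁ w w₂) r₁ , r₂) }))
  (Compose.Good-⨾ M (NGSM^⇒Good (suc k) h))

total : ∀ {A : Set} → List (List A) → ℕ
total []         = 0
total (xs ∷ xss) = length xs + total xss

length-≤-total : ∀ {A : Set} {xs} {xss : List (List A)} → xs ∈ xss → length xs ≤ total xss
length-≤-total {xs = xs}            (here refl) = m≤m+n (length xs) _
length-≤-total {xss = ys ∷ xss} (there p)   = ≤-trans (length-≤-total p) (m≤n+m (total xss) (length ys))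

module Decompose {a b : ℕ} {R : Rel a b} (G : Good R) (finitary : Finitary R) where
  open Good G

  decode : Fin (size finite) → Γ
  decode = dec finite

  coded : DM (Fin (size finite)) b
  coded = record { DM machine hiding (step) ; step = DM.step machine ∘ decode }

  open Compile coded

  relabelling : Sym a → Fin (size finite) → Bool
  relabelling τ k = ρ τ (decode k)

  decode-relabel : ∀ {xs v} → Relabel relabelling xs v → Relabel ρ xs (map decode v)
  decode-relabel []      = []
  decode-relabel (p ∷ r) = p ∷ decode-relabel r

  encode-relabel : ∀ {xs v} → Relabel ρ xs v → Relabel relabelling xs (map (enc finite) v)
  encode-relabel []      = []
  encode-relabel (_∷_ {x = τ} p r) = subst (T ∘ ρ τ) (≡-sym (dec-enc finite _)) p ∷ encode-relabel r

  decode-encode : ∀ v → map decode (map (enc finite) v) ≡ v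
  decode-encode v = trans (≡-sym (map-∘ v)) (trans (map-cong (dec-enc finite) v) (map-id v))

  decode-accepts : ∀ {v z} → DM.Accepts coded v z → DM.Accepts machine (map decode v) z
  decode-accepts {v} {z} = subst (λ t → DM.Run machine rgt [] (DM.start machine) t z accepted) (map-∘ v)

  encode-accepts : ∀ {v z} → DM.Accepts machine v z → DM.Accepts coded (map (enc finite) v) z
  encode-accepts {v} {z} r = subst (λ t → DM.Run machine rgt [] (DM.start machine) t z accepted)
    (≡-sym (trans (map-∘ (map (enc finite) v)) (cong (map (DM.step machine)) (decode-encode v)))) r

  decomposed : (MREL ⨾F DGSM) a b R
  decomposed = comp (λ w v → Relabel relabelling (marked w) v) (Realized gsm)
    (mrel relabelling (λ _ _ → mk⇔ id id))
    (dgsm gsm gsm-deterministic (λ _ _ → mk⇔ id id))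
    (λ w z → mk⇔ (to w) (λ { (v , r , s) → sound (decode-relabel r) (decode-accepts (gsm-sound v s)) }))
    where
    to : ∀ w {z} → R w z → ((λ w v → Relabel relabelling (marked w) v) ⨾ Realized gsm) w z
    -- Finitarity enters only as a bound on the length of outputs: the total length of the finite
    -- list that contains them.
    to w r with complete {w} (λ s → length-≤-total (proj₂ (finitary w) _ s)) r
    ... | v , rel , s = map (enc finite) v , encode-relabel rel , gsm-complete _ (encode-accepts s)

theorem6p9 : (a b : ℕ) (m : Rel a b) (k : ℕ) → 1 ≤ k →
    (NGSM ^ k) a b m → Finitary m → (MREL ⨾F DGSM) a b m
theorem6p9 a b m k _ h finitary = Decompose.decomposed (NGSM^⇒Good k h) finitary
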